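{- Let $n\ge4$ be an integer. The inertia of the distance matrix $D(H_n)$ of the helm graph $H_n$ is $$\mathrm{In}(D(H_n))=\begin{cases}(1,\,2n-2,\,0)&\text{if $n$ is even},\\ (1,\,2n-3,\,1)&\text{if $n$ is odd}.\end{cases}$$
   Context: The inertia $\mathrm{In}(M)$ of a real symmetric matrix $M$ is the ordered triple $(i_+,i_-,i_0)$ of the numbers of positive, negative and zero eigenvalues of $M$, counted with multiplicity. Helm graph: for $n\ge4$, the wheel $W_n$ consists of a cycle on $v_1,\dots,v_{n-1}$ together with a vertex $v_0$ adjacent to all $v_i$; the helm graph $H_n$ (on $2n-1$ vertices) is obtained from $W_n$ by attaching to each $v_i$, $1\le i\le n-1$, a pendant vertex $u_i$. The distance matrix $D(H_n)$ has as entries the shortest-path distances, with vertices ordered $v_0,v_1,\dots,v_{n-1},u_1,\dots,u_{n-1}$. Explicitly, $$D(H_n)=\begin{bmatrix}0&\mathbf{e}'&2\mathbf{e}'\\ \mathbf{e}&2J_{n-1}-S&3J_{n-1}-S\\ 2\mathbf{e}&3J_{n-1}-S&4J_{n-1}-S-2I_{n-1}\end{bmatrix},$$ where a prime denotes transpose, $\mathbf{e}\in\mathbb{R}^{n-1}$ is the all-ones vector, $J_{n-1}$ the all-ones matrix, $I_{n-1}$ the identity, and $S$ is the circulant matrix of order $n-1$ with first row $(2,1,0,\dots,0,1)$ (each row is the previous one cyclically shifted one place to the right). -}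

module Defs where

open import Algebra.Bundles using (CommutativeRing)
open import Data.Fin using (Fin; zero; suc; toℕ; splitAt)
open import Data.List using (List; filter; length)
open import Data.Nat using (ℕ; suc; _+_; _∸_; _≤_; s≤s)
open import Data.Nat.Properties using (1+n≢n)
open import Data.Product using (∃; ∃-syntax; _×_; _,_)
open import Data.Sum using (_⊎_; inj₁; inj₂; [_,_]′)
open import Data.Vec.Functional using (Vector)
open import Function using (_on_)
open import Level using (0ℓ)
open import Relation.Binary using (Rel; Symmetric; Irreflexive; IsStrictTotalOrder)
import Relation.Binary.Construct.Closure.Symmetric as Sym
open Sym using (SymClosure; fwd; bwd)
open import Relation.Binary.PropositionalEquality using (_≡_; refl; sym)
open import Relation.Nullary using (¬_)
open import Relation.Unary using (Pred)
import Algebra.Properties.Semiring.Mult as Mult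
import Algebra.Properties.Semiring.Sum as Sum

-- The real numbers, axiomatised classically as a Dedekind-complete ordered
-- field (unique up to isomorphism).  Trichotomy of the order makes both
-- equality and the order decidable.
record Reals : Set₁ where
  infix 4 _<_
  field
    commutativeRing : CommutativeRing 0ℓ 0ℓ
  open CommutativeRing commutativeRing public
    using (Carrier; _≈_; _*_; 0#; 1#; semiring)
    renaming (_+_ to _⊕_)
  field
    _<_                : Rel Carrier 0ℓ
    isStrictTotalOrder : IsStrictTotalOrder _≈_ _<_
    0<1                : 0# < 1#
    +-monoˡ-<          : ∀ {x y} z → x < y → (x ⊕ z) < (y ⊕ z)
    *-positive         : ∀ {x y} → 0# < x → 0# < y → 0# < (x * y)
    inverse            : ∀ x → ¬ (x ≈ 0#) → ∃[ y ] (x * y) ≈ 1#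

  open IsStrictTotalOrder isStrictTotalOrder public
    using (compare; _≟_; _<?_)

  UpperBound : Pred Carrier 0ℓ → Pred Carrier 0ℓ
  UpperBound P b = ∀ x → P x → ¬ (b < x)

  field
    supremum : (P : Pred Carrier 0ℓ) → ∃ P → ∃ (UpperBound P) →
               ∃[ s ] (UpperBound P s × (∀ b → UpperBound P b → ¬ (b < s)))

module Inertia (ℝ : Reals) where
  open Reals ℝ
  open Sum semiring using (sum)
  open Mult semiring renaming (_×_ to _·_)

  Matrix : ℕ → Set
  Matrix m = Fin m → Fin m → Carrier

  fromNatMatrix : ∀ {m} → (Fin m → Fin m → ℕ) → Matrix m
  fromNatMatrix D i j = D i j · 1#

  SymmetricMatrix : ∀ {m} → Matrix m → Set
  SymmetricMatrix M = ∀ i j → M i j ≈ M j i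

  combination : ∀ {m d} → Vector Carrier d → Vector (Vector Carrier m) d → Vector Carrier m
  combination c b i = sum (λ k → c k * b k i)

  record IsBasis {m d} (V : Pred (Vector Carrier m) 0ℓ) (b : Vector (Vector Carrier m) d) : Set where
    field
      member      : ∀ k → V (b k)
      independent : ∀ c → (∀ i → combination c b i ≈ 0#) → ∀ k → c k ≈ 0#
      spanning    : ∀ v → V v → ∃[ c ] (∀ i → combination c b i ≈ v i)

  HasDimension : ∀ {m} → Pred (Vector Carrier m) 0ℓ → ℕ → Set
  HasDimension {m} V d = ∃[ b ] IsBasis {m} {d} V b

  Eigenspace : ∀ {m} → Matrix m → Carrier → Pred (Vector Carrier m) 0ℓ
  Eigenspace M μ v = ∀ i → sum (λ j → M i j * v j) ≈ (μ * v i)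

  -- λs lists the eigenvalues of M with multiplicity: every real μ occurs in
  -- λs exactly as often as the dimension of its eigenspace (so not at all
  -- when μ is not an eigenvalue).  For the real symmetric matrices considered
  -- here geometric and algebraic multiplicities coincide.
  IsSpectrum : ∀ {m} → Matrix m → List Carrier → Set
  IsSpectrum M λs = ∀ μ → HasDimension (Eigenspace M μ) (length (filter (_≟ μ) λs))

  HasInertia : ∀ {m} → Matrix m → ℕ × ℕ × ℕ → Set
  HasInertia M (i₊ , i₋ , i₀) =
    SymmetricMatrix M ×
    ∃[ λs ] (IsSpectrum M λs ×
             length (filter (0# <?_) λs) ≡ i₊ ×
             length (filter (_<? 0#) λs) ≡ i₋ ×
             length (filter (_≟ 0#) λs) ≡ i₀)

record SimpleGraph (m : ℕ) : Set₁ where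
  field
    Adj         : Rel (Fin m) 0ℓ
    symmetric   : Symmetric Adj
    irreflexive : Irreflexive _≡_ Adj

data Walk {m} (G : SimpleGraph m) : Fin m → Fin m → ℕ → Set where
  []  : ∀ {u} → Walk G u u 0
  _∷_ : ∀ {u v w k} → SimpleGraph.Adj G u v → Walk G v w k → Walk G u w (suc k)

-- A walk of minimal length is a path, so this is the shortest-path distance.
record DistanceMatrix {m} (G : SimpleGraph m) : Set where
  field
    dist    : Fin m → Fin m → ℕ
    walk    : ∀ u v → Walk G u v (dist u v)
    minimal : ∀ {u v k} → Walk G u v k → dist u v ≤ k

-- hub is v₀; with 0-based indices, rim i is v_{i+1} and pendant i is u_{i+1}.
data HelmVertex (N : ℕ) : Set where
  hub     : HelmVertex N
  rim     : Fin N → HelmVertex N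
  pendant : Fin N → HelmVertex N

-- j = i + 1 modulo N
CyclicSuc : ∀ {N} → Fin N → Fin N → Set
CyclicSuc {N} i j = (toℕ j ≡ suc (toℕ i)) ⊎ (suc (toℕ i) ≡ N × toℕ j ≡ 0)

data HelmEdge (N : ℕ) : Rel (HelmVertex N) 0ℓ where
  spoke : ∀ i → HelmEdge N hub (rim i)
  cycle : ∀ {i j} → CyclicSuc i j → HelmEdge N (rim i) (rim j)
  leaf  : ∀ i → HelmEdge N (rim i) (pendant i)

-- The vertex ordering v₀, v₁, …, v_N, u₁, …, u_N.
helmVertex : ∀ N → Fin (1 + (N + N)) → HelmVertex N
helmVertex N zero    = hub
helmVertex N (suc x) = [ rim , pendant ]′ (splitAt N x)

HelmAdj : ∀ N → Rel (HelmVertex N) 0ℓ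
HelmAdj N = SymClosure (HelmEdge N)

helmEdge-irreflexive : ∀ N x → ¬ HelmEdge (2 + N) x x
helmEdge-irreflexive N (rim i) (cycle (inj₁ eq))         = 1+n≢n (sym eq)
helmEdge-irreflexive N (rim i) (cycle (inj₂ (eq , i≡0))) rewrite i≡0 with eq
... | ()

helmAdj-irreflexive : ∀ N x → ¬ HelmAdj (2 + N) x x
helmAdj-irreflexive N x (fwd e) = helmEdge-irreflexive N x e
helmAdj-irreflexive N x (bwd e) = helmEdge-irreflexive N x e

-- H_n, on 1 + ((n ∸ 1) + (n ∸ 1)) = 2n − 1 vertices.
helm : ∀ n → 4 ≤ n → SimpleGraph (1 + ((n ∸ 1) + (n ∸ 1)))
helm n 4≤n = record
  { Adj         = HelmAdj (n ∸ 1) on helmVertex (n ∸ 1)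
  ; symmetric   = Sym.symmetric (HelmEdge (n ∸ 1))
  ; irreflexive = λ { {x} refl → irr 4≤n (helmVertex (n ∸ 1) x) }
  }
  where
  irr : ∀ {n} → 4 ≤ n → ∀ x → ¬ HelmAdj (n ∸ 1) x x
  irr (s≤s (s≤s (s≤s (s≤s {n = k} _)))) = helmAdj-irreflexive (suc k)

{-# OPTIONS --safe #-}
-- For x = (a, y, z) on hub, rim and pendants, put p = Σ yᵢ, q = Σ zᵢ and w = y + z.  Then
--   x′D x = 2(p + 2q)(a + p + q) − Σ (wᵢ + wᵢ₋₁)² − 2 Σ zᵢ²,
-- so D is negative semidefinite on the hyperplane p + 2q = 0, which is also the first equation of
-- D x = 0.  Hence D has at most one positive eigenvalue, and exactly one since x′D x > 0 for some x.
-- A kernel vector has z = 0 and y alternating around the rim, whence p = 0 and a = 0; a nonzero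
-- alternating y exists exactly when the rim has even length, that is, when n is odd.
-- Over the axiomatic reals the eigenvalues themselves come from the spectral theorem: the lowest
-- eigenvalue is a supremum, and one deflates along its eigenvector by a Householder reflection.
module Submission where

open import Defs
open import Algebra.Bundles using (CommutativeRing)
import Algebra.Properties.Ring
import Algebra.Properties.Semiring.Mult
import Algebra.Properties.Semiring.Mult.TCOptimised
import Algebra.Properties.Semiring.Sum
import Algebra.Solver.Ring
open import Algebra.Solver.Ring.AlmostCommutativeRing using (fromCommutativeRing; _-Raw-AlmostCommutative⟶_)
open import Data.Bool using (true; false)
open import Data.Empty using (⊥; ⊥-elim)
open import Data.Fin using (Fin; zero; suc; toℕ; fromℕ; inject₁; splitAt; _↑ˡ_; _↑ʳ_) renaming (_≟_ to _≟ᶠ_)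
open import Data.Fin.Induction using (<-weakInduction)
import Data.Fin.Properties as Fin
open import Data.Integer using (ℤ; +_; -[1+_])
import Data.Integer as ℤ
import Data.Integer.Properties as ℤ
open import Data.List using (List; []; _∷_; lookup; length; map; filter)
open import Data.List.Membership.Propositional.Properties using (∈-lookup)
open import Data.List.Properties using (length-map; filter-some)
open import Data.List.Relation.Unary.All as All using (All; []; _∷_)
import Data.List.Relation.Unary.All.Properties as All
open import Data.List.Relation.Unary.AllPairs as AllPairs using (AllPairs; []; _∷_)
import Data.List.Relation.Unary.AllPairs.Properties as AllPairs
open import Data.Maybe using (Maybe; just; nothing)
open import Data.Nat using (ℕ; zero; suc; z≤n; s≤s)
import Data.Nat as ℕ
open import Data.Nat.Divisibility using (_∣_; ∣m+n∣m⇒∣n; ∣-refl; ∣m∣n⇒∣m+n; _∣0; ∣⇒≤)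
import Data.Nat.Properties as ℕ
import Data.Nat.Solver
open import Data.Product using (∃-syntax; Σ-syntax; _×_; _,_; proj₁; proj₂)
open import Data.Sign using (Sign)
open import Data.Sum using (_⊎_; inj₁; inj₂; [_,_]′)
open import Data.Vec.Functional using (Vector; tail)
open import Function using (_∘_; _on_)
open import Level using (0ℓ)
open import Relation.Binary using (tri<; tri≈; tri>; IsStrictTotalOrder)
open import Relation.Binary.Construct.Closure.Symmetric using (fwd; bwd)
open import Relation.Binary.PropositionalEquality as ≡ using (_≡_)
import Relation.Binary.Reasoning.Setoid
open import Relation.Nullary using (¬_; Dec; yes; no; does)
import Relation.Unary as U

-- `HasInertia` asks for a list of reals that matches the dimension of every eigenspace, so signs of
-- a diagonalised quadratic form do not suffice: the eigenvalues themselves must be produced. The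
-- obstacle is that the minimum of the Rayleigh quotient must be attained, while the axioms offer
-- suprema of sets of reals and not compactness of the sphere. An algebraic dichotomy takes its
-- place: elimination yields either a uniform ε > 0 with ⟨Ax,x⟩ ≥ ε⟨x,x⟩ or a nonzero vector on
-- which the form is not positive. For A = L - s with s the supremum, the first outcome would raise
-- s, and the second gives an eigenvector because a zero of a semidefinite form lies in the kernel.
-- Square roots serve only to normalise eigenvectors. The formula for x′D x has three sources: S is
-- the signless Laplacian of the rim, hence a Gram matrix; the block -2I gives -2 Σ zᵢ²; all the
-- rest is a form of rank two, the product of p + 2q and 2(a + p + q). Negative eigenvalues are
-- never counted directly: they are what remains of the 2n - 1.

module OrderedField (ℝ : Reals) where

  open Reals ℝ public
    using (commutativeRing; _<_; isStrictTotalOrder; 0<1; +-monoˡ-<; *-positive; inverse; compare; _≟_; _<?_; UpperBound; supremum)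
  open CommutativeRing commutativeRing public hiding (zero)
  open IsStrictTotalOrder isStrictTotalOrder public
    using (<-respˡ-≈; <-respʳ-≈) renaming (trans to <-trans; irrefl to <-irrefl; asym to <-asym)
  open Algebra.Properties.Ring ring public using (-0#≈0#; -‿distribˡ-*; -‿distribʳ-*; -‿involutive)
  module ≈-Reasoning = Relation.Binary.Reasoning.Setoid setoid

  -- The ring solver cancels terms only if equality of coefficients computes. Trichotomy in an
  -- abstract field does not, so the coefficients are integers.
  module IntegerCoefficients where
    open Algebra.Properties.Semiring.Mult.TCOptimised semiring using (×1-homo-*; ×-homo-+; 1+×) renaming (_×_ to _·_)
    open Algebra.Properties.Ring ring using (-‿+-comm)
    open ≈-Reasoning

    -- With this variant of multiples, `1 · 1#` is `1#` itself rather than `1# + 0#`, so `con (+ 1)`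
    -- denotes `1#` on the nose.
    ⟦_⟧ : ℤ → Carrier
    ⟦ + n ⟧      = n · 1#
    ⟦ -[1+ n ] ⟧ = - (suc n · 1#)

    ⊖-homo : ∀ m n → ⟦ m ℤ.⊖ n ⟧ ≈ m · 1# - n · 1#
    ⊖-homo m zero = begin
      m · 1#        ≈⟨ +-identityʳ _ ⟨
      m · 1# + 0#   ≈⟨ +-congˡ -0#≈0# ⟨
      m · 1# - 0#   ∎
    ⊖-homo zero (suc n) = sym (+-identityˡ _)
    ⊖-homo (suc m) (suc n) = begin
      ⟦ suc m ℤ.⊖ suc n ⟧                  ≡⟨ ≡.cong ⟦_⟧ (ℤ.[1+m]⊖[1+n]≡m⊖n m n) ⟩
      ⟦ m ℤ.⊖ n ⟧                          ≈⟨ ⊖-homo m n ⟩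
      m · 1# - n · 1#                      ≈⟨ +-congˡ (+-identityˡ _) ⟨
      m · 1# + (0# - n · 1#)               ≈⟨ +-congˡ (+-congʳ (-‿inverseʳ 1#)) ⟨
      m · 1# + (1# - 1# - n · 1#)          ≈⟨ +-congˡ (+-assoc 1# _ _) ⟩
      m · 1# + (1# + (- 1# - n · 1#))      ≈⟨ +-assoc _ _ _ ⟨
      m · 1# + 1# + (- 1# - n · 1#)        ≈⟨ +-cong (+-comm _ _) (-‿+-comm 1# _) ⟩
      1# + m · 1# - (1# + n · 1#)          ≈⟨ +-cong (1+× m 1#) (-‿cong (1+× n 1#)) ⟨
      suc m · 1# - suc n · 1#              ∎

    -◃-homo : ∀ n → ⟦ Sign.- ℤ.◃ n ⟧ ≈ - (n · 1#)
    -◃-homo zero    = sym -0#≈0#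
    -◃-homo (suc n) = refl

    +◃-homo : ∀ n → ⟦ Sign.+ ℤ.◃ n ⟧ ≈ n · 1#
    +◃-homo zero    = refl
    +◃-homo (suc n) = refl

    +-homo : ∀ x y → ⟦ x ℤ.+ y ⟧ ≈ ⟦ x ⟧ + ⟦ y ⟧
    +-homo (+ m)    (+ n)    = ×-homo-+ 1# m n
    +-homo (+ m)    -[1+ n ] = ⊖-homo m (suc n)
    +-homo -[1+ m ] (+ n)    = trans (⊖-homo n (suc m)) (+-comm _ _)
    +-homo -[1+ m ] -[1+ n ] = begin
      - (suc (suc (m ℕ.+ n)) · 1#)       ≡⟨ ≡.cong (λ k → - (suc k · 1#)) (≡.sym (ℕ.+-suc m n)) ⟩
      - ((suc m ℕ.+ suc n) · 1#)         ≈⟨ -‿cong (×-homo-+ 1# (suc m) (suc n)) ⟩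
      - (suc m · 1# + suc n · 1#)        ≈⟨ -‿+-comm _ _ ⟨
      - (suc m · 1#) - (suc n · 1#)      ∎

    *-homo : ∀ x y → ⟦ x ℤ.* y ⟧ ≈ ⟦ x ⟧ * ⟦ y ⟧
    *-homo (+ m)    (+ n)    = trans (+◃-homo (m ℕ.* n)) (×1-homo-* m n)
    *-homo (+ m)    -[1+ n ] = begin
      ⟦ Sign.- ℤ.◃ (m ℕ.* suc n) ⟧   ≈⟨ trans (-◃-homo (m ℕ.* suc n)) (-‿cong (×1-homo-* m (suc n))) ⟩
      - (m · 1# * (suc n · 1#))      ≈⟨ -‿distribʳ-* _ _ ⟩
      m · 1# * - (suc n · 1#)        ∎
    *-homo -[1+ m ] (+ n)    = begin
      ⟦ Sign.- ℤ.◃ (suc m ℕ.* n) ⟧   ≈⟨ trans (-◃-homo (suc m ℕ.* n)) (-‿cong (×1-homo-* (suc m) n)) ⟩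
      - (suc m · 1# * (n · 1#))      ≈⟨ -‿distribˡ-* _ _ ⟩
      - (suc m · 1#) * (n · 1#)      ∎
    *-homo -[1+ m ] -[1+ n ] = begin
      (suc m ℕ.* suc n) · 1#             ≈⟨ ×1-homo-* (suc m) (suc n) ⟩
      suc m · 1# * (suc n · 1#)          ≈⟨ -‿involutive _ ⟨
      - - (suc m · 1# * (suc n · 1#))    ≈⟨ -‿cong (-‿distribʳ-* _ _) ⟩
      - (suc m · 1# * - (suc n · 1#))    ≈⟨ -‿distribˡ-* _ _ ⟩
      - (suc m · 1#) * - (suc n · 1#)    ∎

    -‿homo : ∀ x → ⟦ ℤ.- x ⟧ ≈ - ⟦ x ⟧
    -‿homo (+ zero)  = sym -0#≈0#
    -‿homo (+ suc n) = refl
    -‿homo -[1+ n ]  = sym (-‿involutive _)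

    morphism : ℤ.+-*-rawRing -Raw-AlmostCommutative⟶ fromCommutativeRing commutativeRing
    morphism = record
      { ⟦_⟧ = ⟦_⟧ ; +-homo = +-homo ; *-homo = *-homo ; -‿homo = -‿homo ; 0-homo = refl ; 1-homo = refl }

    _coeff≟_ : ∀ x y → Maybe (⟦ x ⟧ ≈ ⟦ y ⟧)
    x coeff≟ y with x ℤ.≟ y
    ... | yes ≡.refl = just refl
    ... | no _       = nothing

  open Algebra.Solver.Ring ℤ.+-*-rawRing (fromCommutativeRing commutativeRing)
    IntegerCoefficients.morphism IntegerCoefficients._coeff≟_ public
    using (Polynomial; solve; _:=_; _:+_; _:*_; _:-_; :-_; con)

  :0 :1 :2 : ∀ {n} → Polynomial n
  :0 = con (+ 0)
  :1 = con (+ 1)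
  :2 = :1 :+ :1

  -- Order arithmetic and square roots.

  infix 4 _≤_
  _≤_ : Carrier → Carrier → Set
  x ≤ y = ¬ (y < x)

  ≤-refl : ∀ {x y} → x ≈ y → x ≤ y
  ≤-refl x≈y y<x = <-irrefl (sym x≈y) y<x

  <⇒≤ : ∀ {x y} → x < y → x ≤ y
  <⇒≤ = <-asym

  ≤⇒<⊎≈ : ∀ {x y} → x ≤ y → x < y ⊎ x ≈ y
  ≤⇒<⊎≈ {x} {y} x≤y with compare x y
  ... | tri< x<y _ _ = inj₁ x<y
  ... | tri≈ _ x≈y _ = inj₂ x≈y
  ... | tri> _ _ y<x = ⊥-elim (x≤y y<x)

  <-resp : ∀ {x x′ y y′} → x ≈ x′ → y ≈ y′ → x < y → x′ < y′
  <-resp x≈ y≈ x<y = <-respˡ-≈ x≈ (<-respʳ-≈ y≈ x<y)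

  ≤-resp : ∀ {x x′ y y′} → x ≈ x′ → y ≈ y′ → x ≤ y → x′ ≤ y′
  ≤-resp x≈ y≈ x≤y y<x = x≤y (<-resp (sym y≈) (sym x≈) y<x)

  <⇒0<- : ∀ {x y} → x < y → 0# < y - x
  <⇒0<- {x} {y} x<y = <-respˡ-≈ (-‿inverseʳ x) (+-monoˡ-< (- x) x<y)

  0<-⇒< : ∀ {x y} → 0# < y - x → x < y
  0<-⇒< {x} {y} 0<y-x = <-resp (+-identityˡ x) (solve 2 (λ x y → y :- x :+ x := y) refl x y) (+-monoˡ-< x 0<y-x)

  0≤-⇒≤ : ∀ {x y} → 0# ≤ y - x → x ≤ y
  0≤-⇒≤ {x} {y} 0≤y-x y<x =
    0≤y-x (<-resp (+-comm _ _) (-‿inverseʳ x) (<-respˡ-≈ (+-comm _ _) (+-monoˡ-< (- x) y<x)))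

  ≤⇒0≤- : ∀ {x y} → x ≤ y → 0# ≤ y - x
  ≤⇒0≤- {x} {y} x≤y y-x<0 = x≤y (<-resp (solve 2 (λ x y → y :- x :+ x := y) refl x y) (+-identityˡ x) (+-monoˡ-< x y-x<0))

  <0⇒0<- : ∀ {x} → x < 0# → 0# < - x
  <0⇒0<- x<0 = <-respʳ-≈ (+-identityˡ _) (<⇒0<- x<0)

  0<-⇒<0 : ∀ {x} → 0# < - x → x < 0#
  0<-⇒<0 0<-x = 0<-⇒< (<-respʳ-≈ (sym (+-identityˡ _)) 0<-x)

  0<+0≤ : ∀ {x y} → 0# < x → 0# ≤ y → 0# < x + y
  0<+0≤ {x} {y} 0<x 0≤y with ≤⇒<⊎≈ 0≤y
  ... | inj₁ 0<y = <-trans 0<y (<-respˡ-≈ (+-identityˡ y) (+-monoˡ-< y 0<x))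
  ... | inj₂ 0≈y = <-respʳ-≈ (trans (sym (+-identityʳ x)) (+-congˡ 0≈y)) 0<x

  0≤+0≤ : ∀ {x y} → 0# ≤ x → 0# ≤ y → 0# ≤ x + y
  0≤+0≤ {x} {y} 0≤x 0≤y with ≤⇒<⊎≈ 0≤x
  ... | inj₁ 0<x = <⇒≤ (0<+0≤ 0<x 0≤y)
  ... | inj₂ 0≈x = ≤-resp refl (trans (sym (+-identityˡ y)) (+-congʳ 0≈x)) 0≤y

  0≤*0≤ : ∀ {x y} → 0# ≤ x → 0# ≤ y → 0# ≤ x * y
  0≤*0≤ {x} {y} 0≤x 0≤y with ≤⇒<⊎≈ 0≤x | ≤⇒<⊎≈ 0≤y
  ... | inj₁ 0<x | inj₁ 0<y = <⇒≤ (*-positive 0<x 0<y)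
  ... | inj₂ 0≈x | _        = ≤-refl (trans (sym (zeroˡ y)) (*-congʳ 0≈x))
  ... | _        | inj₂ 0≈y = ≤-refl (trans (sym (zeroʳ x)) (*-congˡ 0≈y))

  ≤-trans : ∀ {x y z} → x ≤ y → y ≤ z → x ≤ z
  ≤-trans {x} {y} {z} x≤y y≤z = 0≤-⇒≤ (≤-resp refl
    (solve 3 (λ x y z → (y :- x) :+ (z :- y) := z :- x) refl x y z) (0≤+0≤ (≤⇒0≤- x≤y) (≤⇒0≤- y≤z)))

  ≤-antisym : ∀ {x y} → x ≤ y → y ≤ x → x ≈ y
  ≤-antisym x≤y y≤x with ≤⇒<⊎≈ x≤y
  ... | inj₁ x<y = ⊥-elim (y≤x x<y)
  ... | inj₂ x≈y = x≈y

  nonzero-sq : ∀ {x} → ¬ (x ≈ 0#) → 0# < x * x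
  nonzero-sq {x} x≉0 with compare x 0#
  ... | tri< x<0 _ _ = <-respʳ-≈ (solve 1 (λ x → :- x :* :- x := x :* x) refl x) (*-positive (<0⇒0<- x<0) (<0⇒0<- x<0))
  ... | tri≈ _ x≈0 _ = ⊥-elim (x≉0 x≈0)
  ... | tri> _ _ 0<x = *-positive 0<x 0<x

  0≤sq : ∀ x → 0# ≤ x * x
  0≤sq x with x ≟ 0#
  ... | yes x≈0 = ≤-refl (sym (trans (*-congʳ x≈0) (zeroˡ x)))
  ... | no x≉0  = <⇒≤ (nonzero-sq x≉0)

  positive⇒nonzero : ∀ {x} → 0# < x → ¬ (x ≈ 0#)
  positive⇒nonzero 0<x x≈0 = <-irrefl (sym x≈0) 0<x

  sq≈0⇒≈0 : ∀ {x} → x * x ≈ 0# → x ≈ 0#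
  sq≈0⇒≈0 {x} x²≈0 with x ≟ 0#
  ... | yes x≈0 = x≈0
  ... | no x≉0  = ⊥-elim (positive⇒nonzero (nonzero-sq x≉0) x²≈0)

  no-zero-divisors : ∀ {x y} → x * y ≈ 0# → ¬ (x ≈ 0#) → y ≈ 0#
  no-zero-divisors {x} {y} xy≈0 x≉0 with inverse x x≉0
  ... | z , xz≈1 = begin
    y            ≈⟨ *-identityˡ y ⟨
    1# * y       ≈⟨ *-congʳ xz≈1 ⟨
    x * z * y    ≈⟨ solve 3 (λ x y z → x :* z :* y := z :* (x :* y)) refl x y z ⟩
    z * (x * y)  ≈⟨ *-congˡ xy≈0 ⟩
    z * 0#       ≈⟨ zeroʳ z ⟩
    0#           ∎
    where open ≈-Reasoning

  inverse-positive : ∀ {x} → 0# < x → ∃[ y ] (0# < y × x * y ≈ 1#)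
  inverse-positive {x} 0<x with inverse x (positive⇒nonzero 0<x)
  ... | y , xy≈1 = y , <-respʳ-≈ yyx≈y (*-positive 0<yy 0<x) , xy≈1
    where
    y≉0 : ¬ (y ≈ 0#)
    y≉0 y≈0 = <-irrefl (trans (sym (zeroʳ x)) (trans (*-congˡ (sym y≈0)) xy≈1)) 0<1
    0<yy = nonzero-sq y≉0
    yyx≈y : y * y * x ≈ y
    yyx≈y = trans (solve 2 (λ x y → y :* y :* x := (x :* y) :* y) refl x y) (trans (*-congʳ xy≈1) (*-identityˡ y))

  2# : Carrier
  2# = 1# + 1#

  0<2 : 0# < 2#
  0<2 = 0<+0≤ 0<1 (<⇒≤ 0<1)

  2x≈0⇒x≈0 : ∀ {x} → x + x ≈ 0# → x ≈ 0#
  2x≈0⇒x≈0 {x} 2x≈0 = no-zero-divisors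
    (trans (solve 1 (λ x → :2 :* x := x :+ x) refl x) 2x≈0) (positive⇒nonzero 0<2)

  0≤+0≤≈0ˡ : ∀ {x y} → 0# ≤ x → 0# ≤ y → x + y ≈ 0# → x ≈ 0#
  0≤+0≤≈0ˡ {x} {y} 0≤x 0≤y x+y≈0 with ≤⇒<⊎≈ 0≤x
  ... | inj₁ 0<x = ⊥-elim (positive⇒nonzero (0<+0≤ 0<x 0≤y) x+y≈0)
  ... | inj₂ 0≈x = sym 0≈x

  0≤+0≤≈0ʳ : ∀ {x y} → 0# ≤ x → 0# ≤ y → x + y ≈ 0# → y ≈ 0#
  0≤+0≤≈0ʳ 0≤x 0≤y x+y≈0 = 0≤+0≤≈0ˡ 0≤y 0≤x (trans (+-comm _ _) x+y≈0)

  *-monoˡ-≤ : ∀ {x y z} → 0# ≤ z → x ≤ y → z * x ≤ z * y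
  *-monoˡ-≤ {x} {y} {z} 0≤z x≤y = 0≤-⇒≤ (≤-resp refl
    (solve 3 (λ x y z → z :* (y :- x) := z :* y :- z :* x) refl x y z) (0≤*0≤ 0≤z (≤⇒0≤- x≤y)))

  0≤*⇒0≤ : ∀ {x y} → 0# < x → 0# ≤ x * y → 0# ≤ y
  0≤*⇒0≤ {x} {y} 0<x 0≤xy y<0 = 0≤xy (0<-⇒<0 (<-respʳ-≈ (sym (-‿distribʳ-* x y)) (*-positive 0<x (<0⇒0<- y<0))))

  sq-cancel-≤ : ∀ {x y} → 0# < y → x * x ≤ y * y → x ≤ y
  sq-cancel-≤ {x} {y} 0<y x²≤y² y<x = x²≤y² (0<-⇒< (<-respʳ-≈
    (solve 2 (λ x y → (x :- y) :* (y :+ y :+ (x :- y)) := x :* x :- y :* y) refl x y)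
    (*-positive (<⇒0<- y<x) (0<+0≤ (0<+0≤ 0<y (<⇒≤ 0<y)) (<⇒≤ (<⇒0<- y<x))))))

  -- If s = sup {x | x² ≤ a} had s² ≠ a, then s + δ with δ = (a − s²)/(2s + 1 + (a − s²)),
  -- respectively the Newton step (s + a/s)/2, would contradict s being the supremum.
  sqrt : ∀ {a} → 0# < a → ∃[ s ] s * s ≈ a
  sqrt {a} 0<a with supremum (λ x → x * x ≤ a) (0# , ≤-resp (sym (zeroˡ 0#)) refl (<⇒≤ 0<a)) (1# + a , bound)
    where
    -- The number `a` itself would fail for a < 1; here (1 + a)² - a = 1 + a + a².
    bound : UpperBound (λ x → x * x ≤ a) (1# + a)
    bound x x²≤a = sq-cancel-≤ (0<+0≤ 0<1 (<⇒≤ 0<a)) (≤-trans x²≤a (0≤-⇒≤ (≤-resp refl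
      (solve 1 (λ a → :1 :+ (a :+ a :* a) := (:1 :+ a) :* (:1 :+ a) :- a) refl a)
      (0≤+0≤ (<⇒≤ 0<1) (0≤+0≤ (<⇒≤ 0<a) (0≤sq a))))))
  ... | s , upper , least with compare (s * s) a
  ...   | tri≈ _ s²≈a _ = s , s²≈a
  ...   | tri< s²<a _ _ = ⊥-elim (upper (s + δ) s+δ∈ (0<-⇒< (<-respʳ-≈ (solve 2 (λ s δ → δ := s :+ δ :- s) refl s δ) 0<δ)))
    where
    d = a - s * s
    0<d = <⇒0<- s²<a
    0≤s : 0# ≤ s
    0≤s = upper 0# (≤-resp (sym (zeroˡ 0#)) refl (<⇒≤ 0<a))
    e = 2# * s + 1# + d
    0<e : 0# < e
    0<e = 0<+0≤ (<-respʳ-≈ (+-comm _ _) (0<+0≤ 0<1 (0≤*0≤ (<⇒≤ 0<2) 0≤s))) (<⇒≤ 0<d)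
    e⁻¹ = proj₁ (inverse-positive 0<e)
    δ = d * e⁻¹
    0<δ : 0# < δ
    0<δ = *-positive 0<d (proj₁ (proj₂ (inverse-positive 0<e)))
    eδ≈d : e * δ ≈ d
    eδ≈d = trans (solve 3 (λ e d i → e :* (d :* i) := d :* (e :* i)) refl e d e⁻¹)
      (trans (*-congˡ (proj₂ (proj₂ (inverse-positive 0<e)))) (*-identityʳ d))
    -- a − (s + δ)² = d − 2sδ − δ² = eδ − 2sδ − δ² = δ(1 + d − δ), and d − δ = (e − 1)δ.
    s+δ∈ : (s + δ) * (s + δ) ≤ a
    s+δ∈ = 0≤-⇒≤ (≤-resp refl eq (0≤*0≤ (<⇒≤ 0<δ) (0≤+0≤ (<⇒≤ 0<1) (0≤*0≤ 0≤e-1 (<⇒≤ 0<δ)))))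
      where
      0≤e-1 : 0# ≤ 2# * s + d
      0≤e-1 = 0≤+0≤ (0≤*0≤ (<⇒≤ 0<2) 0≤s) (<⇒≤ 0<d)
      open ≈-Reasoning
      eq : δ * (1# + (2# * s + d) * δ) ≈ a - (s + δ) * (s + δ)
      eq = begin
        δ * (1# + (2# * s + d) * δ)
          ≈⟨ solve 3 (λ δ s d → δ :* (:1 :+ (:2 :* s :+ d) :* δ)
               := δ :* (:1 :+ (((:2 :* s :+ :1 :+ d) :* δ) :- δ))) refl δ s d ⟩
        δ * (1# + (e * δ - δ))
          ≈⟨ *-congˡ (+-congˡ (+-congʳ eδ≈d)) ⟩
        δ * (1# + (d - δ))
          ≈⟨ solve 3 (λ δ s d → δ :* (:1 :+ (d :- δ)) :=
               (:2 :* s :+ :1 :+ d) :* δ :- (:2 :* s :* δ :+ δ :* δ)) refl δ s d ⟩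
        e * δ - (2# * s * δ + δ * δ)
          ≈⟨ +-congʳ eδ≈d ⟩
        a - s * s - (2# * s * δ + δ * δ)
          ≈⟨ solve 3 (λ a s δ → a :- s :* s :- (:2 :* s :* δ :+ δ :* δ) := a :- (s :+ δ) :* (s :+ δ)) refl a s δ ⟩
        a - (s + δ) * (s + δ) ∎
  ...   | tri> _ _ a<s² = ⊥-elim (least t t-upper (0<-⇒< (<-respʳ-≈ s-t (*-positive 0<d (*-positive 0<h 0<s⁻¹)))))
    where
    s≉0 : ¬ (s ≈ 0#)
    s≉0 s≈0 = <-asym 0<a (<-respʳ-≈ (trans (*-congʳ s≈0) (zeroˡ s)) a<s²)
    0<s : 0# < s
    0<s with ≤⇒<⊎≈ (upper 0# (≤-resp (sym (zeroˡ 0#)) refl (<⇒≤ 0<a)))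
    ... | inj₁ 0<s = 0<s
    ... | inj₂ 0≈s = ⊥-elim (s≉0 (sym 0≈s))
    0<d = <⇒0<- a<s²
    s⁻¹ = proj₁ (inverse-positive 0<s)
    0<s⁻¹ = proj₁ (proj₂ (inverse-positive 0<s))
    ss⁻¹≈1 = proj₂ (proj₂ (inverse-positive 0<s))
    h = proj₁ (inverse-positive 0<2)
    0<h = proj₁ (proj₂ (inverse-positive 0<2))
    2h≈1 = proj₂ (proj₂ (inverse-positive 0<2))
    t = h * (s + a * s⁻¹)
    0<t : 0# < t
    0<t = *-positive 0<h (0<+0≤ 0<s (<⇒≤ (*-positive 0<a 0<s⁻¹)))
    open ≈-Reasoning
    a≈ : s * (a * s⁻¹) ≈ a
    a≈ = trans (solve 3 (λ s a i → s :* (a :* i) := a :* (s :* i)) refl s a s⁻¹) (trans (*-congˡ ss⁻¹≈1) (*-identityʳ a))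
    s-t : (s * s - a) * (h * s⁻¹) ≈ s - t
    s-t = begin
      (s * s - a) * (h * s⁻¹)
        ≈⟨ solve 4 (λ s a h i → (s :* s :- a) :* (h :* i) := h :* (s :* (s :* i)) :- h :* (a :* i)) refl s a h s⁻¹ ⟩
      h * (s * (s * s⁻¹)) - h * (a * s⁻¹)
        ≈⟨ +-congʳ (*-congˡ (*-congˡ ss⁻¹≈1)) ⟩
      h * (s * 1#) - h * (a * s⁻¹)
        ≈⟨ solve 3 (λ s h b → h :* (s :* :1) :- h :* b
             := (:2 :* h) :* s :- h :* (s :+ b)) refl s h (a * s⁻¹) ⟩
      2# * h * s - t
        ≈⟨ +-congʳ (trans (*-congʳ 2h≈1) (*-identityˡ s)) ⟩
      s - t ∎
    -- The square of the mean of s and a/s exceeds their product `a` by the square of half their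
    -- difference.
    t²-a : (h * (s - a * s⁻¹)) * (h * (s - a * s⁻¹)) ≈ t * t - a
    t²-a = begin
      (h * (s - a * s⁻¹)) * (h * (s - a * s⁻¹))
        ≈⟨ solve 3 (λ s h b → (h :* (s :- b)) :* (h :* (s :- b)) :=
             (h :* (s :+ b)) :* (h :* (s :+ b)) :- (:2 :* h) :* (:2 :* h) :* (s :* b)) refl s h (a * s⁻¹) ⟩
      t * t - (2# * h) * (2# * h) * (s * (a * s⁻¹))
        ≈⟨ +-congˡ (-‿cong (*-cong (*-cong 2h≈1 2h≈1) a≈)) ⟩
      t * t - 1# * 1# * a
        ≈⟨ solve 2 (λ t a → t :* t :- :1 :* :1 :* a := t :* t :- a) refl t a ⟩
      t * t - a ∎
    t-upper : UpperBound (λ x → x * x ≤ a) t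
    t-upper x x²≤a = sq-cancel-≤ 0<t (≤-trans x²≤a (0≤-⇒≤ (≤-resp refl t²-a (0≤sq _))))

-- The Euclidean inner product.

module InnerProduct (ℝ : Reals) where

  open OrderedField ℝ
  open Algebra.Properties.Semiring.Sum semiring public
    using (sum; sum-cong-≋; ∑-distrib-+; *-distribˡ-sum; *-distribʳ-sum; ∑-comm; sum-replicate-zero; sum-init-last)

  V : ℕ → Set
  V m = Vector Carrier m

  infix 4 _≋_
  _≋_ : ∀ {m} → V m → V m → Set
  x ≋ y = ∀ i → x i ≈ y i

  ⟨_,_⟩ : ∀ {m} → V m → V m → Carrier
  ⟨ x , y ⟩ = sum (λ i → x i * y i)

  infixr 7 _•_
  _•_ : ∀ {m} → Carrier → V m → V m
  (c • x) i = c * x i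

  lin : ∀ {m} → Carrier → V m → Carrier → V m → V m
  lin a x b y i = a * x i + b * y i

  𝟎 : ∀ {m} → V m
  𝟎 _ = 0#

  infixr 5 _∷ᵥ_
  _∷ᵥ_ : ∀ {m} → Carrier → V m → V (suc m)
  (c ∷ᵥ x) zero    = c
  (c ∷ᵥ x) (suc i) = x i

  e : ∀ {m} → Fin m → V m
  e zero    = 1# ∷ᵥ 𝟎
  e (suc i) = 0# ∷ᵥ e i

  ip-cong : ∀ {m} {x x′ y y′ : V m} → x ≋ x′ → y ≋ y′ → ⟨ x , y ⟩ ≈ ⟨ x′ , y′ ⟩
  ip-cong x≋ y≋ = sum-cong-≋ (λ i → *-cong (x≋ i) (y≋ i))

  ip-congˡ : ∀ {m} (x : V m) {y y′} → y ≋ y′ → ⟨ x , y ⟩ ≈ ⟨ x , y′ ⟩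
  ip-congˡ x = ip-cong {x = x} (λ _ → refl)

  ip-congʳ : ∀ {m} (y : V m) {x x′} → x ≋ x′ → ⟨ x , y ⟩ ≈ ⟨ x′ , y ⟩
  ip-congʳ y x≋ = ip-cong {y = y} x≋ (λ _ → refl)

  ip-comm : ∀ {m} (x y : V m) → ⟨ x , y ⟩ ≈ ⟨ y , x ⟩
  ip-comm x y = sum-cong-≋ (λ i → *-comm (x i) (y i))

  ip-•ˡ : ∀ {m} c (x y : V m) → ⟨ c • x , y ⟩ ≈ c * ⟨ x , y ⟩
  ip-•ˡ c x y = trans (sum-cong-≋ (λ i → *-assoc c (x i) (y i))) (sym (*-distribˡ-sum c (λ i → x i * y i)))

  ip-•ʳ : ∀ {m} c (x y : V m) → ⟨ x , c • y ⟩ ≈ c * ⟨ x , y ⟩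
  ip-•ʳ c x y = trans (ip-comm x (c • y)) (trans (ip-•ˡ c y x) (*-congˡ (ip-comm y x)))

  ip-linˡ : ∀ {m} a (x : V m) b y z → ⟨ lin a x b y , z ⟩ ≈ a * ⟨ x , z ⟩ + b * ⟨ y , z ⟩
  ip-linˡ a x b y z = begin
    ⟨ lin a x b y , z ⟩                              ≈⟨ sum-cong-≋ (λ i → distribʳ (z i) (a * x i) (b * y i)) ⟩
    sum (λ i → a * x i * z i + b * y i * z i)        ≈⟨ ∑-distrib-+ (λ i → a * x i * z i) (λ i → b * y i * z i) ⟩
    ⟨ a • x , z ⟩ + ⟨ b • y , z ⟩                    ≈⟨ +-cong (ip-•ˡ a x z) (ip-•ˡ b y z) ⟩
    a * ⟨ x , z ⟩ + b * ⟨ y , z ⟩                    ∎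
    where open ≈-Reasoning

  ip-linʳ : ∀ {m} a (x : V m) b y z → ⟨ z , lin a x b y ⟩ ≈ a * ⟨ z , x ⟩ + b * ⟨ z , y ⟩
  ip-linʳ a x b y z = trans (ip-comm z (lin a x b y))
    (trans (ip-linˡ a x b y z) (+-cong (*-congˡ (ip-comm x z)) (*-congˡ (ip-comm y z))))

  ip-𝟎ˡ : ∀ {m} (x : V m) → ⟨ 𝟎 , x ⟩ ≈ 0#
  ip-𝟎ˡ {m} x = trans (sum-cong-≋ (λ i → zeroˡ (x i))) (sum-replicate-zero m)

  ip-𝟎ʳ : ∀ {m} (x : V m) → ⟨ x , 𝟎 ⟩ ≈ 0#
  ip-𝟎ʳ x = trans (ip-comm x 𝟎) (ip-𝟎ˡ x)

  ip-e : ∀ {m} (x : V m) i → ⟨ x , e i ⟩ ≈ x i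
  ip-e x zero    = trans (+-cong (*-identityʳ (x zero)) (ip-𝟎ʳ (tail x))) (+-identityʳ (x zero))
  ip-e x (suc i) = trans (+-cong (zeroʳ (x zero)) (ip-e (tail x) i)) (+-identityˡ (x (suc i)))

  ip-0∷ʳ : ∀ {m} (x : V (suc m)) y → ⟨ x , 0# ∷ᵥ y ⟩ ≈ ⟨ tail x , y ⟩
  ip-0∷ʳ x y = trans (+-congʳ (zeroʳ (x zero))) (+-identityˡ _)

  ip-0∷ˡ : ∀ {m} (x : V (suc m)) y → ⟨ 0# ∷ᵥ y , x ⟩ ≈ ⟨ y , tail x ⟩
  ip-0∷ˡ x y = trans (+-congʳ (zeroˡ (x zero))) (+-identityˡ _)

  nondegenerate : ∀ {m} {x y : V m} → (∀ z → ⟨ x , z ⟩ ≈ ⟨ y , z ⟩) → x ≋ y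
  nondegenerate {x = x} {y} eq i = trans (sym (ip-e x i)) (trans (eq (e i)) (ip-e y i))

  sum-0≤ : ∀ {m} (f : V m) → (∀ i → 0# ≤ f i) → 0# ≤ sum f
  sum-0≤ {zero}  f 0≤f = ≤-refl refl
  sum-0≤ {suc m} f 0≤f = 0≤+0≤ (0≤f zero) (sum-0≤ (tail f) (λ i → 0≤f (suc i)))

  sum≈0⇒≈0 : ∀ {m} (f : V m) → (∀ i → 0# ≤ f i) → sum f ≈ 0# → ∀ i → f i ≈ 0#
  sum≈0⇒≈0 f 0≤f eq zero    = 0≤+0≤≈0ˡ (0≤f zero) (sum-0≤ (tail f) (λ i → 0≤f (suc i))) eq
  sum≈0⇒≈0 f 0≤f eq (suc i) =
    sum≈0⇒≈0 (tail f) (λ i → 0≤f (suc i)) (0≤+0≤≈0ʳ (0≤f zero) (sum-0≤ (tail f) (λ i → 0≤f (suc i))) eq) i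

  0≤norm : ∀ {m} (x : V m) → 0# ≤ ⟨ x , x ⟩
  0≤norm x = sum-0≤ (λ i → x i * x i) (λ i → 0≤sq (x i))

  norm≈0⇒≋𝟎 : ∀ {m} (x : V m) → ⟨ x , x ⟩ ≈ 0# → x ≋ 𝟎
  norm≈0⇒≋𝟎 x eq i = sq≈0⇒≈0 (sum≈0⇒≈0 (λ i → x i * x i) (λ i → 0≤sq (x i)) eq i)

  -- The part of x orthogonal to y, scaled by r = ⟨y,y⟩ to avoid division, has squared norm r(pr -
  -- q²), and a positive r cancels. If r vanishes, so does y.
  cauchy-schwarz : ∀ {m} (x y : V m) → ⟨ x , y ⟩ * ⟨ x , y ⟩ ≤ ⟨ x , x ⟩ * ⟨ y , y ⟩
  cauchy-schwarz x y with ≤⇒<⊎≈ (0≤norm y)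
  ... | inj₂ 0≈yy = ≤-refl (trans (*-congʳ xy≈0) (trans (zeroˡ _) (trans (sym (zeroʳ _)) (*-congˡ 0≈yy))))
    where
    xy≈0 : ⟨ x , y ⟩ ≈ 0#
    xy≈0 = trans (ip-congˡ x (norm≈0⇒≋𝟎 y (sym 0≈yy))) (ip-𝟎ʳ x)
  ... | inj₁ 0<yy = 0≤-⇒≤ (0≤*⇒0≤ 0<yy (≤-resp refl expand (0≤norm z)))
    where
    open ≈-Reasoning
    p = ⟨ x , x ⟩
    q = ⟨ x , y ⟩
    r = ⟨ y , y ⟩
    z = lin r x (- q) y
    expand : ⟨ z , z ⟩ ≈ r * (p * r - q * q)
    expand = begin
      ⟨ z , z ⟩                            ≈⟨ ip-linˡ r x (- q) y z ⟩
      r * ⟨ x , z ⟩ + - q * ⟨ y , z ⟩      ≈⟨ +-cong (*-congˡ (ip-linʳ r x (- q) y x)) (*-congˡ (ip-linʳ r x (- q) y y)) ⟩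
      r * (r * p + - q * q) + - q * (r * ⟨ y , x ⟩ + - q * r)
        ≈⟨ +-congˡ (*-congˡ (+-congʳ (*-congˡ (ip-comm y x)))) ⟩
      r * (r * p + - q * q) + - q * (r * q + - q * r)
        ≈⟨ solve 3 (λ p q r → r :* (r :* p :+ :- q :* q) :+ :- q :* (r :* q :+ :- q :* r) := r :* (p :* r :- q :* q)) refl p q r ⟩
      r * (p * r - q * q)                  ∎

-- Self-adjointness alone already forces an operator to respect _≋_ and to be linear, because the
-- inner product is nondegenerate.
module SelfAdjointOperator (ℝ : Reals) where

  open OrderedField ℝ
  open InnerProduct ℝ
  open ≈-Reasoning

  Operator : ℕ → Set
  Operator m = V m → V m

  record SelfAdjoint {m} (L : Operator m) : Set where
    constructor selfAdjoint
    field adjoint : ∀ x y → ⟨ L x , y ⟩ ≈ ⟨ x , L y ⟩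
  open SelfAdjoint public

  form : ∀ {m} → Operator m → V m → Carrier
  form L x = ⟨ L x , x ⟩

  module _ {m} {L : Operator m} (sa : SelfAdjoint L) where

    L-cong : ∀ {x y} → x ≋ y → L x ≋ L y
    L-cong {x} {y} x≋y = nondegenerate λ z → trans (adjoint sa x z) (trans (ip-congʳ (L z) x≋y) (sym (adjoint sa y z)))

    L-lin : ∀ a x b y → L (lin a x b y) ≋ lin a (L x) b (L y)
    L-lin a x b y = nondegenerate λ z → begin
      ⟨ L (lin a x b y) , z ⟩              ≈⟨ adjoint sa (lin a x b y) z ⟩
      ⟨ lin a x b y , L z ⟩                ≈⟨ ip-linˡ a x b y (L z) ⟩
      a * ⟨ x , L z ⟩ + b * ⟨ y , L z ⟩    ≈⟨ +-cong (*-congˡ (adjoint sa x z)) (*-congˡ (adjoint sa y z)) ⟨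
      a * ⟨ L x , z ⟩ + b * ⟨ L y , z ⟩    ≈⟨ ip-linˡ a (L x) b (L y) z ⟨
      ⟨ lin a (L x) b (L y) , z ⟩          ∎

    L-• : ∀ c x → L (c • x) ≋ c • L x
    L-• c x = nondegenerate λ z → begin
      ⟨ L (c • x) , z ⟩    ≈⟨ adjoint sa (c • x) z ⟩
      ⟨ c • x , L z ⟩      ≈⟨ ip-•ˡ c x (L z) ⟩
      c * ⟨ x , L z ⟩      ≈⟨ *-congˡ (adjoint sa x z) ⟨
      c * ⟨ L x , z ⟩      ≈⟨ ip-•ˡ c (L x) z ⟨
      ⟨ c • L x , z ⟩      ∎

    form-cong : ∀ {x y} → x ≋ y → form L x ≈ form L y
    form-cong x≋y = ip-cong (L-cong x≋y) x≋y

    form-lin : ∀ a x b y → form L (lin a x b y) ≈ a * a * form L x + 2# * (a * b * ⟨ L x , y ⟩) + b * b * form L y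
    form-lin a x b y = begin
      ⟨ L (lin a x b y) , lin a x b y ⟩
        ≈⟨ ip-congʳ (lin a x b y) (L-lin a x b y) ⟩
      ⟨ lin a (L x) b (L y) , lin a x b y ⟩
        ≈⟨ ip-linˡ a (L x) b (L y) (lin a x b y) ⟩
      a * ⟨ L x , lin a x b y ⟩ + b * ⟨ L y , lin a x b y ⟩
        ≈⟨ +-cong (*-congˡ (ip-linʳ a x b y (L x))) (*-congˡ (ip-linʳ a x b y (L y))) ⟩
      a * (a * form L x + b * ⟨ L x , y ⟩) + b * (a * ⟨ L y , x ⟩ + b * form L y)
        ≈⟨ +-congˡ (*-congˡ (+-congʳ (*-congˡ (trans (ip-comm (L y) x) (sym (adjoint sa x y)))))) ⟩
      a * (a * form L x + b * ⟨ L x , y ⟩) + b * (a * ⟨ L x , y ⟩ + b * form L y)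
        ≈⟨ solve 5 (λ a b p q r → a :* (a :* p :+ b :* q) :+ b :* (a :* q :+ b :* r)
             := a :* a :* p :+ :2 :* (a :* b :* q) :+ b :* b :* r) refl a b (form L x) ⟨ L x , y ⟩ (form L y) ⟩
      a * a * form L x + 2# * (a * b * ⟨ L x , y ⟩) + b * b * form L y ∎

  -- Principal blocks, shifts, rank-one updates, and positive definiteness.

  compress : ∀ {m} → Operator (suc m) → Operator m
  compress L x = tail (L (0# ∷ᵥ x))

  compress-selfAdjoint : ∀ {m} {L : Operator (suc m)} → SelfAdjoint L → SelfAdjoint (compress L)
  compress-selfAdjoint {L = L} sa = selfAdjoint λ x y → begin
    ⟨ compress L x , y ⟩           ≈⟨ ip-0∷ʳ (L (0# ∷ᵥ x)) y ⟨
    ⟨ L (0# ∷ᵥ x) , 0# ∷ᵥ y ⟩      ≈⟨ adjoint sa (0# ∷ᵥ x) (0# ∷ᵥ y) ⟩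
    ⟨ 0# ∷ᵥ x , L (0# ∷ᵥ y) ⟩      ≈⟨ ip-0∷ˡ (L (0# ∷ᵥ y)) x ⟩
    ⟨ x , compress L y ⟩           ∎

  shift : ∀ {m} → Carrier → Operator m → Operator m
  shift s L x = lin 1# (L x) (- s) x

  form-shift : ∀ {m} s (L : Operator m) x → form (shift s L) x ≈ form L x - s * ⟨ x , x ⟩
  form-shift s L x = trans (ip-linˡ 1# (L x) (- s) x x)
    (solve 3 (λ p s q → :1 :* p :+ :- s :* q := p :- s :* q) refl (form L x) s ⟨ x , x ⟩)

  shift-selfAdjoint : ∀ {m} s {L : Operator m} → SelfAdjoint L → SelfAdjoint (shift s L)
  shift-selfAdjoint s {L} sa = selfAdjoint λ x y → begin
    ⟨ lin 1# (L x) (- s) x , y ⟩              ≈⟨ ip-linˡ 1# (L x) (- s) x y ⟩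
    1# * ⟨ L x , y ⟩ + - s * ⟨ x , y ⟩        ≈⟨ +-congʳ (*-congˡ (adjoint sa x y)) ⟩
    1# * ⟨ x , L y ⟩ + - s * ⟨ x , y ⟩        ≈⟨ ip-linʳ 1# (L y) (- s) y x ⟨
    ⟨ x , lin 1# (L y) (- s) y ⟩              ∎

  -- The operator L - k u u′. One construction covers two uses: the Schur complement (k the inverse
  -- of the corner entry) and the Householder reflection (L the identity, k = 2/⟨u,u⟩).
  rankOne : ∀ {m} → Carrier → V m → Operator m → Operator m
  rankOne k u L x = lin 1# (L x) (- (k * ⟨ u , x ⟩)) u

  ip-rankOne : ∀ {m} k u (L : Operator m) x y → ⟨ rankOne k u L x , y ⟩ ≈ ⟨ L x , y ⟩ - k * ⟨ u , x ⟩ * ⟨ u , y ⟩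
  ip-rankOne k u L x y = trans (ip-linˡ 1# (L x) (- (k * ⟨ u , x ⟩)) u y)
    (solve 3 (λ p q r → :1 :* p :+ :- q :* r := p :- q :* r) refl ⟨ L x , y ⟩ (k * ⟨ u , x ⟩) ⟨ u , y ⟩)

  rankOne-selfAdjoint : ∀ {m} k u {L : Operator m} → SelfAdjoint L → SelfAdjoint (rankOne k u L)
  rankOne-selfAdjoint k u {L} sa = selfAdjoint λ x y → begin
    ⟨ rankOne k u L x , y ⟩                    ≈⟨ ip-rankOne k u L x y ⟩
    ⟨ L x , y ⟩ - k * ⟨ u , x ⟩ * ⟨ u , y ⟩    ≈⟨ +-cong (trans (adjoint sa x y) (ip-comm x (L y)))
         (-‿cong (solve 3 (λ k p q → k :* p :* q := k :* q :* p) refl k ⟨ u , x ⟩ ⟨ u , y ⟩)) ⟩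
    ⟨ L y , x ⟩ - k * ⟨ u , y ⟩ * ⟨ u , x ⟩    ≈⟨ ip-rankOne k u L y x ⟨
    ⟨ rankOne k u L y , x ⟩                    ≈⟨ ip-comm (rankOne k u L y) x ⟩
    ⟨ x , rankOne k u L y ⟩                    ∎

  -- Uniform in ε, not just positive on nonzero vectors: the margin ε is what lets a lower bound of
  -- the form be increased, in place of compactness.
  PositiveDefinite : ∀ {m} → Operator m → Set
  PositiveDefinite L = ∃[ ε ] (0# < ε × (∀ x → ε * ⟨ x , x ⟩ ≤ form L x))

  -- Gaussian elimination: if the corner entry a of L is positive, completing the square reduces
  -- the form of L to that of the Schur complement.
  positiveDefinite-or-not : ∀ {m} {L : Operator m} → SelfAdjoint L →
    PositiveDefinite L ⊎ (∃[ x ] (0# < ⟨ x , x ⟩ × form L x ≤ 0#))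
  positiveDefinite-or-not {zero}  sa = inj₁ (1# , 0<1 , λ _ → ≤-refl (zeroʳ 1#))
  positiveDefinite-or-not {suc m} {L} sa = elimination
    where
    e₀ : V (suc m)
    e₀ = e zero
    a = L e₀ zero
    b = tail (L e₀)
    form-e₀ : form L e₀ ≈ a
    form-e₀ = ip-e (L e₀) zero
    elimination : PositiveDefinite L ⊎ (∃[ x ] (0# < ⟨ x , x ⟩ × form L x ≤ 0#))
    elimination with 0# <? a
    ... | no 0≮a = inj₂ (e₀ , <-respʳ-≈ (sym (ip-e e₀ zero)) 0<1 , ≤-resp (sym form-e₀) refl 0≮a)
    ... | yes 0<a with inverse-positive 0<a
    ...   | i , 0<i , ai≈1 = step (positiveDefinite-or-not S-selfAdjoint)
      where
      S : Operator m
      S = rankOne i b (compress L)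
      S-selfAdjoint : SelfAdjoint S
      S-selfAdjoint = rankOne-selfAdjoint i b (compress-selfAdjoint sa)
      form-split : ∀ c y → form L (c ∷ᵥ y) ≈ a * ((c + i * ⟨ b , y ⟩) * (c + i * ⟨ b , y ⟩)) + form S y
      form-split c y = begin
        form L (c ∷ᵥ y)
          ≈⟨ form-cong sa {c ∷ᵥ y} {lin c e₀ 1# (0# ∷ᵥ y)} split ⟩
        form L (lin c e₀ 1# (0# ∷ᵥ y))
          ≈⟨ form-lin sa c e₀ 1# (0# ∷ᵥ y) ⟩
        c * c * form L e₀ + 2# * (c * 1# * ⟨ L e₀ , 0# ∷ᵥ y ⟩) + 1# * 1# * form L (0# ∷ᵥ y)
          ≈⟨ +-cong (+-cong (*-congˡ form-e₀) (*-congˡ (*-congˡ (ip-0∷ʳ (L e₀) y)))) (*-congˡ (ip-0∷ʳ (L (0# ∷ᵥ y)) y)) ⟩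
        c * c * a + 2# * (c * 1# * p) + 1# * 1# * q
          ≈⟨ solve 5 (λ a c i p q → c :* c :* a :+ :2 :* (c :* :1 :* p) :+ :1 :* :1 :* q :=
               a :* (c :* c) :+ :2 :* (:1 :* c :* p) :+ :1 :* (i :* p :* p) :+ (q :- i :* p :* p)) refl a c i p q ⟩
        a * (c * c) + 2# * (1# * c * p) + 1# * (i * p * p) + (q - i * p * p)
          ≈⟨ +-cong (+-cong (+-congˡ (*-congˡ (*-congʳ (*-congʳ ai≈1)))) (*-congʳ ai≈1)) (ip-rankOne i b (compress L) y y) ⟨
        a * (c * c) + 2# * (a * i * c * p) + a * i * (i * p * p) + form S y
          ≈⟨ +-congʳ (solve 4 (λ a c i p → a :* (c :* c) :+ :2 :* (a :* i :* c :* p) :+ a :* i :* (i :* p :* p)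
               := a :* ((c :+ i :* p) :* (c :+ i :* p))) refl a c i p) ⟩
        a * ((c + i * p) * (c + i * p)) + form S y ∎
        where
        p = ⟨ b , y ⟩
        q = form (compress L) y
        split : c ∷ᵥ y ≋ lin c e₀ 1# (0# ∷ᵥ y)
        split zero    = solve 1 (λ c → c := c :* :1 :+ :1 :* :0) refl c
        split (suc j) = solve 2 (λ c z → z := c :* :0 :+ :1 :* z) refl c (y j)
      step : PositiveDefinite S ⊎ (∃[ y ] (0# < ⟨ y , y ⟩ × form S y ≤ 0#)) →
             PositiveDefinite L ⊎ (∃[ x ] (0# < ⟨ x , x ⟩ × form L x ≤ 0#))
      step (inj₂ (y , 0<yy , Sy≤0)) = inj₂ (x , 0<xx , ≤-resp (sym formx) refl Sy≤0)
        where
        -- The choice of first coordinate that annihilates the completed square, leaving the form of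
        -- the Schur complement.
        c = - (i * ⟨ b , y ⟩)
        x = c ∷ᵥ y
        0<xx : 0# < ⟨ x , x ⟩
        0<xx = <-respʳ-≈ (+-comm _ _) (0<+0≤ 0<yy (0≤sq c))
        formx : form L x ≈ form S y
        formx = trans (form-split c y) (solve 3 (λ a t s → a :* ((:- t :+ t) :* (:- t :+ t)) :+ s := s) refl a (i * ⟨ b , y ⟩) (form S y))
      step (inj₁ (ε , 0<ε , pd)) = inj₁ (ε′ , 0<ε′ , bound)
        where
        β = i * i * ⟨ b , b ⟩
        0≤β : 0# ≤ β
        0≤β = 0≤*0≤ (0≤sq i) (0≤norm b)
        γ = 1# + 2# * β
        0<γ : 0# < γ
        0<γ = 0<+0≤ 0<1 (0≤*0≤ (<⇒≤ 0<2) 0≤β)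
        d = 2# * ε + a * γ
        0<d : 0# < d
        0<d = 0<+0≤ (*-positive 0<2 0<ε) (<⇒≤ (*-positive 0<a 0<γ))
        d⁻¹ = proj₁ (inverse-positive 0<d)
        0<d⁻¹ = proj₁ (proj₂ (inverse-positive 0<d))
        dd⁻¹≈1 = proj₂ (proj₂ (inverse-positive 0<d))
        -- This is 1/(2/a + γ/ε), small enough for both requirements below: 2ε′ ≤ a, to absorb the
        -- square of u, and ε′γ ≤ ε, to absorb ⟨y,y⟩.
        ε′ = ε * a * d⁻¹
        0<ε′ : 0# < ε′
        0<ε′ = *-positive (*-positive 0<ε 0<a) 0<d⁻¹
        0≤a-2ε′ : 0# ≤ a - 2# * ε′
        0≤a-2ε′ = ≤-resp refl eq (0≤*0≤ (<⇒≤ (*-positive 0<a (*-positive 0<a 0<γ))) (<⇒≤ 0<d⁻¹))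
          where
          eq : a * (a * γ) * d⁻¹ ≈ a - 2# * ε′
          eq = begin
            a * (a * γ) * d⁻¹
              ≈⟨ solve 4 (λ a e g d → a :* (a :* g) :* d := a :* ((:2 :* e :+ a :* g) :* d)
                   :- :2 :* (e :* a :* d)) refl a ε γ d⁻¹ ⟩
            a * (d * d⁻¹) - 2# * ε′  ≈⟨ +-congʳ (trans (*-congˡ dd⁻¹≈1) (*-identityʳ a)) ⟩
            a - 2# * ε′              ∎
        0≤ε-ε′γ : 0# ≤ ε - ε′ * γ
        0≤ε-ε′γ = ≤-resp refl eq (0≤*0≤ (<⇒≤ (*-positive 0<ε (*-positive 0<2 0<ε))) (<⇒≤ 0<d⁻¹))
          where
          eq : ε * (2# * ε) * d⁻¹ ≈ ε - ε′ * γ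
          eq = begin
            ε * (2# * ε) * d⁻¹
              ≈⟨ solve 4 (λ a e g d → e :* (:2 :* e) :* d := e :* ((:2 :* e :+ a :* g) :* d)
                   :- e :* a :* d :* g) refl a ε γ d⁻¹ ⟩
            ε * (d * d⁻¹) - ε′ * γ   ≈⟨ +-congʳ (trans (*-congˡ dd⁻¹≈1) (*-identityʳ ε)) ⟩
            ε - ε′ * γ               ∎
        -- With t = i⟨b,y⟩ and u = c + t, :1 has c² ≤ 2u² + 2t² and t² ≤ β⟨y,y⟩.
        bound : ∀ x → ε′ * ⟨ x , x ⟩ ≤ form L x
        bound x = 0≤-⇒≤ (≤-resp refl eq
          (0≤+0≤ (0≤+0≤ (0≤+0≤ (0≤+0≤ (0≤*0≤ 0≤a-2ε′ (0≤sq u)) (≤⇒0≤- (pd y))) (0≤*0≤ 0≤ε-ε′γ (0≤norm y)))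
            (0≤*0≤ (<⇒≤ 0<ε′) (0≤sq (u + t)))) (0≤*0≤ (<⇒≤ (*-positive 0<2 0<ε′)) (≤⇒0≤- t²≤))))
          where
          c = x zero
          y = tail x
          p = ⟨ b , y ⟩
          n = ⟨ y , y ⟩
          t = i * p
          u = c + t
          t²≤ : t * t ≤ β * n
          t²≤ = ≤-resp (solve 2 (λ i p → i :* i :* (p :* p) := i :* p :* (i :* p)) refl i p)
            (sym (*-assoc (i * i) ⟨ b , b ⟩ n)) (*-monoˡ-≤ (0≤sq i) (cauchy-schwarz b y))
          eq : (a - 2# * ε′) * (u * u) + (form S y - ε * n) + (ε - ε′ * γ) * n + ε′ * ((u + t) * (u + t)) + 2# * ε′ * (β * n - t * t)
               ≈ form L x - ε′ * ⟨ x , x ⟩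
          eq = trans (solve 8 (λ a c t s n e e′ B → let u = c :+ t in
                 (a :- :2 :* e′) :* (u :* u) :+ (s :- e :* n) :+ (e :- e′ :* (:1 :+ :2 :* B)) :* n
                 :+ e′ :* ((u :+ t) :* (u :+ t)) :+ :2 :* e′ :* (B :* n :- t :* t)
                 := (a :* (u :* u) :+ s) :- e′ :* (c :* c :+ n)) refl a c t (form S y) n ε ε′ β)
               (+-congʳ (trans (sym (form-split c y)) (form-cong sa {c ∷ᵥ y} {x} λ { zero → refl ; (suc _) → refl })))

-- The spectral theorem.

module SpectralTheorem (ℝ : Reals) where

  open OrderedField ℝ
  open InnerProduct ℝ
  open SelfAdjointOperator ℝ
  open ≈-Reasoning

  -- For p = ⟨Lx,Lx⟩ > 0 and q = form L (Lx), the form of (1 + q)x − p Lx is −p²(2 + q) < 0.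
  semidefinite-kernel : ∀ {m} {L : Operator m} → SelfAdjoint L → (∀ x → 0# ≤ form L x) →
                        ∀ x → form L x ≤ 0# → L x ≋ 𝟎
  semidefinite-kernel {L = L} sa 0≤form x formx≤0 with ≤⇒<⊎≈ (0≤norm (L x))
  ... | inj₂ 0≈p = norm≈0⇒≋𝟎 (L x) (sym 0≈p)
  ... | inj₁ 0<p = ⊥-elim (0≤form z (0<-⇒<0 (<-respʳ-≈ (sym formz) (*-positive (*-positive 0<p 0<p) (0<+0≤ 0<2 (0≤form (L x)))))))
    where
    p = ⟨ L x , L x ⟩
    q = form L (L x)
    z = lin (1# + q) x (- p) (L x)
    formz : - form L z ≈ p * p * (2# + q)
    formz = begin
      - form L z
        ≈⟨ -‿cong (form-lin sa (1# + q) x (- p) (L x)) ⟩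
      - ((1# + q) * (1# + q) * form L x + 2# * ((1# + q) * - p * p) + - p * - p * q)
        ≈⟨ -‿cong (+-congʳ (+-congʳ (*-congˡ (≤-antisym formx≤0 (0≤form x))))) ⟩
      - ((1# + q) * (1# + q) * 0# + 2# * ((1# + q) * - p * p) + - p * - p * q)
        ≈⟨ solve 2 (λ p q → :- ((:1 :+ q) :* (:1 :+ q) :* :0 :+ :2 :* ((:1 :+ q) :* :- p :* p)
             :+ :- p :* :- p :* q) := p :* p :* (:2 :+ q)) refl p q ⟩
      p * p * (2# + q) ∎

  -- Shows that the set whose supremum is taken is inhabited. `C` is the squared Frobenius norm, so
  -- Cauchy-Schwarz row by row gives ⟨Lx,Lx⟩ ≤ C⟨x,x⟩; bounding -2⟨Lx,x⟩ by ⟨x,x⟩ + ⟨Lx,Lx⟩ then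
  -- avoids the square root of `C`.
  form-lower-bound : ∀ {m} {L : Operator m} → SelfAdjoint L → ∃[ K ] ∀ x → K * ⟨ x , x ⟩ ≤ form L x
  form-lower-bound {m} {L} sa = - K , bound
    where
    C = sum (λ i → ⟨ L (e i) , L (e i) ⟩)
    K = 1# + C
    0≤C : 0# ≤ C
    0≤C = sum-0≤ {m} (λ i → ⟨ L (e i) , L (e i) ⟩) (λ i → 0≤norm (L (e i)))
    sum-mono : ∀ {k} (f g : V k) → (∀ i → f i ≤ g i) → sum f ≤ sum g
    sum-mono {zero}  f g f≤g = ≤-refl refl
    sum-mono {suc k} f g f≤g = 0≤-⇒≤ (≤-resp refl
      (solve 4 (λ a b c d → (b :- a) :+ (d :- c) := (b :+ d) :- (a :+ c)) refl (f zero) (g zero) (sum (tail f)) (sum (tail g)))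
      (0≤+0≤ (≤⇒0≤- (f≤g zero)) (≤⇒0≤- (sum-mono (tail f) (tail g) (λ i → f≤g (suc i))))))
    norm-L≤ : ∀ x → ⟨ L x , L x ⟩ ≤ C * ⟨ x , x ⟩
    norm-L≤ x = ≤-resp (sum-cong-≋ {m} λ i → *-cong (entry i) (entry i)) (sym (*-distribʳ-sum ⟨ x , x ⟩ (λ i → ⟨ L (e i) , L (e i) ⟩)))
      (sum-mono _ _ (λ i → cauchy-schwarz (L (e i)) x))
      where
      entry : ∀ i → ⟨ L (e i) , x ⟩ ≈ L x i
      entry i = trans (adjoint sa (e i) x) (trans (ip-comm (e i) (L x)) (ip-e (L x) i))
    -- 2 form x + ⟨x,x⟩ + ⟨Lx,Lx⟩ = ⟨x + Lx, x + Lx⟩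
    bound : ∀ x → - K * ⟨ x , x ⟩ ≤ form L x
    bound x = 0≤-⇒≤ (0≤*⇒0≤ 0<2 (≤-resp refl eq (0≤+0≤ (0≤+0≤ (0≤norm z) (≤⇒0≤- (norm-L≤ x))) (0≤*0≤ (0≤+0≤ (<⇒≤ 0<1) 0≤C) (0≤norm x)))))
      where
      z = lin 1# x 1# (L x)
      n = ⟨ x , x ⟩
      q = form L x
      p = ⟨ L x , L x ⟩
      eq : ⟨ z , z ⟩ + (C * n - p) + (1# + C) * n ≈ 2# * (q - - K * n)
      eq = begin
        ⟨ z , z ⟩ + (C * n - p) + (1# + C) * n
          ≈⟨ +-congʳ (+-congʳ (trans (ip-linˡ 1# x 1# (L x) z)
               (+-cong (*-congˡ (ip-linʳ 1# x 1# (L x) x)) (*-congˡ (ip-linʳ 1# x 1# (L x) (L x)))))) ⟩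
        1# * (1# * n + 1# * ⟨ x , L x ⟩) + 1# * (1# * q + 1# * p) + (C * n - p) + (1# + C) * n
          ≈⟨ +-congʳ (+-congʳ (+-congʳ (*-congˡ (+-congˡ (*-congˡ (ip-comm x (L x))))))) ⟩
        1# * (1# * n + 1# * q) + 1# * (1# * q + 1# * p) + (C * n - p) + (1# + C) * n
          ≈⟨ solve 4 (λ n q p C →
               :1 :* (:1 :* n :+ :1 :* q) :+ :1 :* (:1 :* q :+ :1 :* p) :+ (C :* n :- p) :+ (:1 :+ C) :* n
               := :2 :* (q :- :- (:1 :+ C) :* n)) refl n q p C ⟩
        2# * (q - - K * n) ∎

  Below : ∀ {m} → Operator m → Carrier → Set
  Below L μ = ∀ x → μ * ⟨ x , x ⟩ ≤ form L x

  -- Every Rayleigh quotient is an upper bound of `Below L`; a vector violating the claim would have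
  -- one smaller than `s`.
  least-upper-bound-attained : ∀ {m} {L : Operator m} {s} → (∀ b → UpperBound (Below L) b → ¬ (b < s)) → Below L s
  least-upper-bound-attained {L = L} {s} least x q<sn with ≤⇒<⊎≈ (0≤norm x)
  ... | inj₂ 0≈n = <-irrefl (trans formx≈0 (trans (sym (zeroʳ s)) (*-congˡ 0≈n))) q<sn
    where
    formx≈0 : form L x ≈ 0#
    formx≈0 = trans (ip-congˡ (L x) (norm≈0⇒≋𝟎 x (sym 0≈n))) (ip-𝟎ʳ (L x))
  ... | inj₁ 0<n = least t t-upper t<s
    where
    n = ⟨ x , x ⟩
    n⁻¹ = proj₁ (inverse-positive 0<n)
    0<n⁻¹ = proj₁ (proj₂ (inverse-positive 0<n))
    nn⁻¹≈1 = proj₂ (proj₂ (inverse-positive 0<n))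
    t = form L x * n⁻¹
    tn≈q : t * n ≈ form L x
    tn≈q = trans (solve 3 (λ q n i → q :* i :* n := q :* (n :* i)) refl (form L x) n n⁻¹) (trans (*-congˡ nn⁻¹≈1) (*-identityʳ _))
    t-upper : UpperBound (Below L) t
    t-upper μ below t<μ = below x (<-respˡ-≈ tn≈q (0<-⇒< (<-respʳ-≈
      (solve 3 (λ t μ n → (μ :- t) :* n := μ :* n :- t :* n) refl t μ n) (*-positive (<⇒0<- t<μ) 0<n))))
    t<s : t < s
    t<s = 0<-⇒< (<-respʳ-≈ eq (*-positive (<⇒0<- q<sn) 0<n⁻¹))
      where
      eq : (s * n - form L x) * n⁻¹ ≈ s - t
      eq = trans (solve 4 (λ s n q i → (s :* n :- q) :* i := s :* (n :* i) :- q :* i) refl s n (form L x) n⁻¹)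
        (+-congʳ (trans (*-congˡ nn⁻¹≈1) (*-identityʳ s)))

  -- The lowest eigenvalue is s = sup {μ | μ⟨x,x⟩ ≤ form L x for all x}: the operator L − s is
  -- positive semidefinite, but not positive definite, as otherwise s could be increased.
  eigenvector : ∀ {m} {L : Operator (suc m)} → SelfAdjoint L → ∃[ s ] ∃[ x ] (0# < ⟨ x , x ⟩ × L x ≋ s • x)
  eigenvector {m} {L} sa = find (positiveDefinite-or-not A-selfAdjoint)
    where
    Below-bounded : UpperBound (Below L) (form L (e zero))
    Below-bounded μ below = ≤-resp (trans (*-congˡ (ip-e (e {suc m} zero) zero)) (*-identityʳ μ)) refl (below (e zero))
    lowest : ∃[ s ] (UpperBound (Below L) s × (∀ b → UpperBound (Below L) b → b < s → ⊥))
    lowest = supremum (Below L) (form-lower-bound sa) (form L (e zero) , Below-bounded)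
    s : Carrier
    s = proj₁ lowest
    upper : UpperBound (Below L) s
    upper = proj₁ (proj₂ lowest)
    least : ∀ b → UpperBound (Below L) b → b < s → ⊥
    least = proj₂ (proj₂ lowest)
    A : Operator (suc m)
    A = shift s L
    A-selfAdjoint : SelfAdjoint A
    A-selfAdjoint = shift-selfAdjoint s sa
    s-below : Below L s
    s-below = least-upper-bound-attained {L = L} least
    find : PositiveDefinite A ⊎ (∃[ x ] (0# < ⟨ x , x ⟩ × form A x ≤ 0#)) →
           ∃[ s ] ∃[ x ] (0# < ⟨ x , x ⟩ × L x ≋ s • x)
    find (inj₁ (ε , 0<ε , pd)) = ⊥-elim (upper (s + ε) s+ε-below (0<-⇒< (<-respʳ-≈ (solve 2 (λ s d → d := s :+ d :- s) refl s ε) 0<ε)))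
      where
      s+ε-below : ∀ x → (s + ε) * ⟨ x , x ⟩ ≤ form L x
      s+ε-below x = 0≤-⇒≤ (≤-resp refl
        (trans (+-congʳ (form-shift s L x)) (solve 4 (λ q s e n → q :- s :* n :- e :* n := q :- (s :+ e) :* n) refl (form L x) s ε ⟨ x , x ⟩))
        (≤⇒0≤- (pd x)))
    find (inj₂ (x , 0<n , formAx≤0)) = s , x , 0<n , λ i → begin
        L x i                                ≈⟨ solve 3 (λ l s x → l := :1 :* l :+ :- s :* x :+ s :* x) refl (L x i) s (x i) ⟩
        1# * L x i + - s * x i + s * x i     ≈⟨ +-congʳ (semidefinite-kernel A-selfAdjoint 0≤formA x formAx≤0 i) ⟩
        0# + s * x i                         ≈⟨ +-identityˡ _ ⟩
        s * x i                              ∎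
      where
      0≤formA : ∀ x → 0# ≤ form A x
      0≤formA x = ≤-resp refl (sym (form-shift s L x)) (≤⇒0≤- (s-below x))

  norm-• : ∀ {m} r (x : V m) → ⟨ r • x , r • x ⟩ ≈ ⟨ x , x ⟩ * (r * r)
  norm-• r x = begin
    ⟨ r • x , r • x ⟩        ≈⟨ trans (ip-•ˡ r x (r • x)) (*-congˡ (ip-•ʳ r x x)) ⟩
    r * (r * ⟨ x , x ⟩)      ≈⟨ solve 2 (λ r n → r :* (r :* n) := n :* (r :* r)) refl r ⟨ x , x ⟩ ⟩
    ⟨ x , x ⟩ * (r * r)      ∎

  normalise : ∀ {m} (x : V m) → 0# < ⟨ x , x ⟩ → ∃[ r ] ⟨ r • x , r • x ⟩ ≈ 1#
  normalise x 0<n = root (inverse-positive 0<n)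
    where
    unit : ∀ {i} → ⟨ x , x ⟩ * i ≈ 1# → ∃[ r ] r * r ≈ i → ∃[ r ] ⟨ r • x , r • x ⟩ ≈ 1#
    unit ni≈1 (r , rr≈i) = r , trans (norm-• r x) (trans (*-congˡ rr≈i) ni≈1)
    root : ∃[ i ] (0# < i × ⟨ x , x ⟩ * i ≈ 1#) → ∃[ r ] ⟨ r • x , r • x ⟩ ≈ 1#
    root (i , 0<i , ni≈1) = unit ni≈1 (sqrt 0<i)

  eigenvector-• : ∀ {m} {L : Operator m} → SelfAdjoint L → ∀ {s x} r → L x ≋ s • x → L (r • x) ≋ s • (r • x)
  eigenvector-• {L = L} sa {s} {x} r Lx≋sx j = begin
    L (r • x) j        ≈⟨ L-• sa r x j ⟩
    r * L x j          ≈⟨ *-congˡ (Lx≋sx j) ⟩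
    r * (s * x j)      ≈⟨ solve 3 (λ r s x → r :* (s :* x) := s :* (r :* x)) refl r s (x j) ⟩
    s * (r * x j)      ∎

  unit-eigenvector : ∀ {m} {L : Operator (suc m)} → SelfAdjoint L → ∃[ s ] ∃[ x ] (⟨ x , x ⟩ ≈ 1# × L x ≋ s • x)
  unit-eigenvector {L = L} sa = scale (eigenvector sa)
    where
    rescale : ∀ {s x} → L x ≋ s • x → ∃[ r ] ⟨ r • x , r • x ⟩ ≈ 1# → ∃[ s ] ∃[ x ] (⟨ x , x ⟩ ≈ 1# × L x ≋ s • x)
    rescale {s} {x} Lx≋sx (r , unit) = s , r • x , unit , eigenvector-• sa r Lx≋sx
    scale : ∃[ s ] ∃[ x ] (0# < ⟨ x , x ⟩ × L x ≋ s • x) → ∃[ s ] ∃[ x ] (⟨ x , x ⟩ ≈ 1# × L x ≋ s • x)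
    scale (s , x , 0<n , Lx≋sx) = rescale Lx≋sx (normalise x 0<n)

  -- A self-adjoint involution is orthogonal and its own inverse, so conjugation by `R` preserves
  -- self-adjointness, inner products and eigenvalues.
  record Reflection {m} (v : V (suc m)) : Set where
    field
      R           : Operator (suc m)
      R-adjoint   : SelfAdjoint R
      involutive  : ∀ x → R (R x) ≋ x
      R-e₀        : R (e zero) ≋ v

  identity-selfAdjoint : ∀ {m} → SelfAdjoint {m} (λ x → x)
  identity-selfAdjoint = selfAdjoint λ _ _ → refl

  -- Householder: reflect in the hyperplane orthogonal to v − e₀.
  reflection : ∀ {m} (v : V (suc m)) → ⟨ v , v ⟩ ≈ 1# → Reflection v
  reflection {m} v unit with ≤⇒<⊎≈ (0≤norm (lin 1# v (- 1#) (e zero)))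
  -- Here v = e₀, so there is no vector to reflect along and the identity serves.
  ... | inj₂ 0≈n = record
    { R = λ x → x ; R-adjoint = identity-selfAdjoint ; involutive = λ _ _ → refl
    ; R-e₀ = λ i → begin
        e zero i                                    ≈⟨ +-identityʳ _ ⟨
        e zero i + 0#                               ≈⟨ +-congˡ (norm≈0⇒≋𝟎 (lin 1# v (- 1#) (e zero)) (sym 0≈n) i) ⟨
        e zero i + (1# * v i + - 1# * e zero i)     ≈⟨ solve 2 (λ v d → d :+ (:1 :* v :+ :- :1 :* d) := v) refl (v i) (e zero i) ⟩
        v i                                         ∎ }
  ... | inj₁ 0<n = record
    { R = R ; R-adjoint = R-adjoint ; involutive = involutive ; R-e₀ = R-e₀ }
    where
    e₀ : V (suc m)
    e₀ = e zero
    u = lin 1# v (- 1#) e₀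
    n = ⟨ u , u ⟩
    n⁻¹ = proj₁ (inverse-positive 0<n)
    nn⁻¹≈1 = proj₂ (proj₂ (inverse-positive 0<n))
    k = 2# * n⁻¹
    kn≈2 : k * n ≈ 2#
    kn≈2 = trans (solve 2 (λ n i → :2 :* i :* n := :2 :* (n :* i)) refl n n⁻¹)
      (trans (*-congˡ nn⁻¹≈1) (*-identityʳ 2#))
    R : Operator (suc m)
    R = rankOne k u (λ x → x)
    R-adjoint : SelfAdjoint R
    R-adjoint = rankOne-selfAdjoint k u identity-selfAdjoint
    involutive : ∀ x → R (R x) ≋ x
    involutive x i = begin
      1# * (1# * x i + - (k * p) * u i) + - (k * ⟨ u , R x ⟩) * u i
        ≈⟨ +-congˡ (*-congʳ (-‿cong (*-congˡ (ip-linʳ 1# x (- (k * p)) u u)))) ⟩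
      1# * (1# * x i + - (k * p) * u i) + - (k * (1# * p + - (k * p) * n)) * u i
        ≈⟨ solve 5 (λ x u k p n →
             :1 :* (:1 :* x :+ :- (k :* p) :* u) :+ :- (k :* (:1 :* p :+ :- (k :* p) :* n)) :* u
             := x :- (k :* p :* u) :* (:1 :+ :1 :- k :* n)) refl (x i) (u i) k p n ⟩
      x i - (k * p * u i) * (2# - k * n)
        ≈⟨ +-congˡ (-‿cong (*-congˡ (+-congˡ (-‿cong kn≈2)))) ⟩
      x i - (k * p * u i) * (2# - 2#)
        ≈⟨ solve 2 (λ x c → x :- c :* (:2 :- :2) := x) refl (x i) (k * p * u i) ⟩
      x i ∎
      where p = ⟨ u , x ⟩
    -- n = ⟨v − e₀, v − e₀⟩ = 2 − 2v₀ and ⟨u, e₀⟩ = v₀ − 1, so that k⟨u, e₀⟩ = −1.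
    v₀ = v zero
    ue₀ : ⟨ u , e₀ ⟩ ≈ 1# * v₀ + - 1# * 1#
    ue₀ = ip-e u zero
    n≈ : n ≈ 2# * (1# - v₀)
    n≈ = begin
      n
        ≈⟨ trans (ip-linˡ 1# v (- 1#) e₀ u) (+-cong (*-congˡ (ip-linʳ 1# v (- 1#) e₀ v)) (*-congˡ (trans (ip-comm e₀ u) ue₀))) ⟩
      1# * (1# * ⟨ v , v ⟩ + - 1# * ⟨ v , e₀ ⟩) + - 1# * (1# * v₀ + - 1# * 1#)
        ≈⟨ +-congʳ (*-congˡ (+-cong (*-congˡ unit) (*-congˡ (ip-e v zero)))) ⟩
      1# * (1# * 1# + - 1# * v₀) + - 1# * (1# * v₀ + - 1# * 1#)
        ≈⟨ solve 1 (λ v → :1 :* (:1 :* :1 :+ :- :1 :* v) :+ :- :1 :* (:1 :* v :+ :- :1 :* :1)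
             := :2 :* (:1 :- v)) refl v₀ ⟩
      2# * (1# - v₀) ∎
    k[1-v₀]≈1 : k * (1# - v₀) ≈ 1#
    k[1-v₀]≈1 = begin
      2# * n⁻¹ * (1# - v₀)     ≈⟨ solve 2 (λ i w → :2 :* i :* w := :2 :* w :* i) refl n⁻¹ (1# - v₀) ⟩
      2# * (1# - v₀) * n⁻¹     ≈⟨ *-congʳ n≈ ⟨
      n * n⁻¹                  ≈⟨ nn⁻¹≈1 ⟩
      1#                       ∎
    R-e₀ : R e₀ ≋ v
    R-e₀ i = begin
      1# * e₀ i + - (k * ⟨ u , e₀ ⟩) * u i
        ≈⟨ +-congˡ (*-congʳ (-‿cong (*-congˡ ue₀))) ⟩
      1# * e₀ i + - (k * (1# * v₀ + - 1# * 1#)) * u i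
        ≈⟨ solve 4 (λ d k v u → :1 :* d :+ :- (k :* (:1 :* v :+ :- :1 :* :1)) :* u := d :+ (k :* (:1 :- v)) :* u) refl (e₀ i) k v₀ (u i) ⟩
      e₀ i + k * (1# - v₀) * u i
        ≈⟨ +-congˡ (*-congʳ k[1-v₀]≈1) ⟩
      e₀ i + 1# * (1# * v i + - 1# * e₀ i)
        ≈⟨ solve 2 (λ d v → d :+ :1 :* (:1 :* v :+ :- :1 :* d) := v) refl (e₀ i) (v i) ⟩
      v i ∎

  Pair : ℕ → Set
  Pair m = Carrier × V m

  ∑[_]_ : ∀ {m} → List (Pair m) → (Pair m → Carrier) → Carrier
  ∑[ ps ] f = sum (λ k → f (lookup ps k))

  summand : ∀ {m} → V m → V m → Pair m → Carrier
  summand x y (_ , v) = ⟨ x , v ⟩ * ⟨ v , y ⟩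

  -- Completeness is encoded by `parseval`: for y = `e i` it is the expansion of x in the basis, and
  -- for (L x, x) it diagonalises the form. Lists allow the vectors of one eigenvalue to be picked
  -- out by `filter`.
  record Eigenbasis {m} (L : Operator m) : Set where
    field
      pairs       : List (Pair m)
      eigen       : All (λ (μ , v) → L v ≋ μ • v) pairs
      unit        : All (λ (_ , v) → ⟨ v , v ⟩ ≈ 1#) pairs
      orthogonal  : AllPairs (λ (_ , v) (_ , w) → ⟨ v , w ⟩ ≈ 0#) pairs
      parseval    : ∀ x y → ∑[ pairs ] summand x y ≈ ⟨ x , y ⟩
      size        : length pairs ≡ m

  ∑-map : ∀ {m n} (g : Pair m → Pair n) (f : Pair n → Carrier) (h : Pair m → Carrier) ps →
          (∀ p → f (g p) ≈ h p) → ∑[ map g ps ] f ≈ ∑[ ps ] h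
  ∑-map g f h []       fg≈h = refl
  ∑-map g f h (p ∷ ps) fg≈h = +-cong (fg≈h p) (∑-map g f h ps fg≈h)

  -- Transporting a unit eigenvector v to e₀ by a reflection R splits off a one-dimensional block of RLR.
  deflate : ∀ {m} {L : Operator (suc m)} → SelfAdjoint L → ∀ {s v} → ⟨ v , v ⟩ ≈ 1# → L v ≋ s • v →
            (Rv : Reflection v) → let open Reflection Rv in
            Eigenbasis (compress (λ x → R (L (R x)))) → Eigenbasis L
  deflate {m} {L} sa {s} {v} v-unit Lv≋sv Rv IH = record
    { pairs      = (s , v) ∷ map lift IH.pairs
    ; eigen      = Lv≋sv ∷ All.map⁺ (All.map (λ {p} → lift-eigen p) IH.eigen)
    ; unit       = v-unit ∷ All.map⁺ (All.map (λ {p} → trans (lift-ip (proj₂ p) (proj₂ p))) IH.unit)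
    ; orthogonal = All.map⁺ (All.universal (λ p → v⊥lift (proj₂ p)) IH.pairs)
                   ∷ AllPairs.map⁺ (AllPairs.map (λ {p} {q} → trans (lift-ip (proj₂ p) (proj₂ q))) IH.orthogonal)
    ; parseval   = parseval
    ; size       = ≡.cong suc (≡.trans (length-map lift IH.pairs) IH.size)
    }
    where
    open Reflection Rv
    B : Operator (suc m)
    B x = R (L (R x))
    module IH = Eigenbasis IH
    embed : V m → V (suc m)
    embed w = R (0# ∷ᵥ w)
    lift : Pair m → Pair (suc m)
    lift (μ , w) = μ , embed w
    ⟨v,_⟩ : ∀ x → ⟨ v , x ⟩ ≈ R x zero
    ⟨v, x ⟩ = begin
      ⟨ v , x ⟩              ≈⟨ ip-congʳ x R-e₀ ⟨
      ⟨ R (e zero) , x ⟩     ≈⟨ adjoint R-adjoint (e zero) x ⟩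
      ⟨ e zero , R x ⟩       ≈⟨ ip-comm (e zero) (R x) ⟩
      ⟨ R x , e zero ⟩       ≈⟨ ip-e (R x) zero ⟩
      R x zero               ∎
    embed-ip : ∀ w x → ⟨ embed w , x ⟩ ≈ ⟨ w , tail (R x) ⟩
    embed-ip w x = trans (adjoint R-adjoint (0# ∷ᵥ w) x) (ip-0∷ˡ (R x) w)
    lift-ip : ∀ w w′ → ⟨ embed w , embed w′ ⟩ ≈ ⟨ w , w′ ⟩
    lift-ip w w′ = trans (embed-ip w (embed w′)) (ip-congˡ w (λ i → involutive (0# ∷ᵥ w′) (suc i)))
    v⊥lift : ∀ w → ⟨ v , embed w ⟩ ≈ 0#
    v⊥lift w = trans ⟨v, embed w ⟩ (involutive (0# ∷ᵥ w) zero)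
    lift-eigen : ∀ ((μ , w) : Pair m) → compress B w ≋ μ • w → L (embed w) ≋ μ • embed w
    lift-eigen (μ , w) Bw≋μw i = begin
      L (embed w) i              ≈⟨ involutive (L (embed w)) i ⟨
      R (B (0# ∷ᵥ w)) i          ≈⟨ L-cong R-adjoint {B (0# ∷ᵥ w)} {μ • (0# ∷ᵥ w)} B0w i ⟩
      R (μ • (0# ∷ᵥ w)) i        ≈⟨ L-• R-adjoint μ (0# ∷ᵥ w) i ⟩
      μ * embed w i              ∎
      where
      B0w : B (0# ∷ᵥ w) ≋ μ • (0# ∷ᵥ w)
      B0w (suc j) = Bw≋μw j
      -- The coordinate along e₀ of RLR(0, w) is the component of L(embed w) along v, which vanishes
      -- since v is an eigenvector orthogonal to embed w.
      B0w zero = begin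
        R (L (embed w)) zero      ≈⟨ ⟨v, L (embed w) ⟩ ⟨
        ⟨ v , L (embed w) ⟩       ≈⟨ adjoint sa v (embed w) ⟨
        ⟨ L v , embed w ⟩         ≈⟨ ip-congʳ (embed w) Lv≋sv ⟩
        ⟨ s • v , embed w ⟩       ≈⟨ ip-•ˡ s v (embed w) ⟩
        s * ⟨ v , embed w ⟩       ≈⟨ trans (*-congˡ (v⊥lift w)) (zeroʳ s) ⟩
        0#                        ≈⟨ zeroʳ μ ⟨
        μ * 0#                    ∎
    parseval : ∀ x y → ∑[ (s , v) ∷ map lift IH.pairs ] summand x y ≈ ⟨ x , y ⟩
    parseval x y = begin
      ⟨ x , v ⟩ * ⟨ v , y ⟩ + ∑[ map lift IH.pairs ] summand x y
        ≈⟨ +-cong (*-cong (trans (ip-comm x v) ⟨v, x ⟩) ⟨v, y ⟩) (∑-map lift (summand x y) (summand (tail (R x)) (tail (R y))) IH.pairs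
             λ (_ , w) → *-cong (trans (ip-comm x (embed w)) (trans (embed-ip w x) (ip-comm w (tail (R x))))) (embed-ip w y)) ⟩
      R x zero * R y zero + ∑[ IH.pairs ] summand (tail (R x)) (tail (R y))
        ≈⟨ +-congˡ (IH.parseval (tail (R x)) (tail (R y))) ⟩
      ⟨ R x , R y ⟩            ≈⟨ adjoint R-adjoint x (R y) ⟩
      ⟨ x , R (R y) ⟩          ≈⟨ ip-congˡ x (involutive y) ⟩
      ⟨ x , y ⟩                ∎

  eigenbasis : ∀ {m} {L : Operator m} → SelfAdjoint L → Eigenbasis L
  eigenbasis {zero} sa = record
    { pairs = [] ; eigen = [] ; unit = [] ; orthogonal = [] ; parseval = λ _ _ → refl ; size = ≡.refl }
  eigenbasis {suc m} {L} sa = step (unit-eigenvector sa)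
    where
    step : ∃[ s ] ∃[ v ] (⟨ v , v ⟩ ≈ 1# × L v ≋ s • v) → Eigenbasis L
    step (s , v , v-unit , Lv≋sv) = deflate sa v-unit Lv≋sv Rv (eigenbasis (compress-selfAdjoint RLR-selfAdjoint))
      where
      Rv = reflection v v-unit
      open Reflection Rv
      RLR-selfAdjoint : SelfAdjoint (λ x → R (L (R x)))
      RLR-selfAdjoint = selfAdjoint λ x y →
        trans (adjoint R-adjoint (L (R x)) y) (trans (adjoint sa (R x) (R y)) (adjoint R-adjoint x (L (R y))))

length-filter-map : ∀ {A B : Set} {P : U.Pred B 0ℓ} (P? : U.Decidable P) (f : A → B) xs →
                    length (filter P? (map f xs)) ≡ length (filter (P? ∘ f) xs)
length-filter-map P? f []       = ≡.refl
length-filter-map P? f (x ∷ xs) with does (P? (f x))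
... | true  = ≡.cong suc (length-filter-map P? f xs)
... | false = length-filter-map P? f xs

-- Eigenspace dimensions and the count of eigenvalues by sign.

module MatrixSpectrum (ℝ : Reals) where

  open OrderedField ℝ
  open InnerProduct ℝ
  open SelfAdjointOperator ℝ
  open SpectralTheorem ℝ
  open Inertia ℝ
  open ≈-Reasoning

  operator : ∀ {m} → Matrix m → Operator m
  operator M x i = ⟨ M i , x ⟩

  operator-selfAdjoint : ∀ {m} {M : Matrix m} → SymmetricMatrix M → SelfAdjoint (operator M)
  operator-selfAdjoint {m} {M} symmetric = selfAdjoint λ x y → begin
    sum (λ i → sum (λ j → M i j * x j) * y i)      ≈⟨ sum-cong-≋ (λ i → *-distribʳ-sum (y i) (λ j → M i j * x j)) ⟩
    sum (λ i → sum (λ j → M i j * x j * y i))      ≈⟨ ∑-comm (λ i j → M i j * x j * y i) ⟩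
    sum (λ j → sum (λ i → M i j * x j * y i))      ≈⟨ sum-cong-≋ (λ j → sum-cong-≋ (λ i → swap (symmetric i j) (x j) (y i))) ⟩
    sum (λ j → sum (λ i → x j * (M j i * y i)))    ≈⟨ sum-cong-≋ (λ j → sym (*-distribˡ-sum (x j) (λ i → M j i * y i))) ⟩
    ⟨ x , operator M y ⟩                           ∎
    where
    swap : ∀ {a b} → a ≈ b → ∀ x y → a * x * y ≈ x * (b * y)
    swap {a} {b} a≈b x y = trans (*-congʳ (*-congʳ a≈b)) (solve 3 (λ b x y → b :* x :* y := x :* (b :* y)) refl b x y)

  ∑-filter : ∀ {m} {P : U.Pred (Pair m) 0ℓ} (P? : U.Decidable P) (f : Pair m → Carrier) ps →
             All (λ p → ¬ P p → f p ≈ 0#) ps → ∑[ filter P? ps ] f ≈ ∑[ ps ] f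
  ∑-filter P? f []       []             = refl
  ∑-filter P? f (p ∷ ps) (zero-off ∷ z) with P? p
  ... | yes _  = +-congˡ (∑-filter P? f ps z)
  ... | no ¬Pp = trans (∑-filter P? f ps z) (trans (sym (+-identityˡ _)) (+-congʳ (sym (zero-off ¬Pp))))

  Unit : ∀ {m} → Pair m → Set
  Unit (_ , v) = ⟨ v , v ⟩ ≈ 1#

  Orthogonal : ∀ {m} → Pair m → Pair m → Set
  Orthogonal (_ , v) (_ , w) = ⟨ v , w ⟩ ≈ 0#

  vectors : ∀ {m} (ps : List (Pair m)) → Vector (V m) (length ps)
  vectors ps k = proj₂ (lookup ps k)

  ip-combination : ∀ {m d} (c : V d) (b : Vector (V m) d) z → ⟨ combination c b , z ⟩ ≈ sum (λ k → c k * ⟨ b k , z ⟩)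
  ip-combination c b z = begin
    sum (λ i → sum (λ k → c k * b k i) * z i)      ≈⟨ sum-cong-≋ (λ i → *-distribʳ-sum (z i) (λ k → c k * b k i)) ⟩
    sum (λ i → sum (λ k → c k * b k i * z i))      ≈⟨ ∑-comm (λ i k → c k * b k i * z i) ⟩
    sum (λ k → sum (λ i → c k * b k i * z i))      ≈⟨ sum-cong-≋ (λ k → ip-•ˡ (c k) (b k) z) ⟩
    sum (λ k → c k * ⟨ b k , z ⟩)                  ∎

  -- Pairing a vanishing combination with the head vector isolates the head coefficient; dropping
  -- that term leaves a vanishing combination of the tail.
  orthonormal⇒independent : ∀ {m} (ps : List (Pair m)) → All Unit ps → AllPairs Orthogonal ps →
    ∀ c → combination c (vectors ps) ≋ 𝟎 → ∀ k → c k ≈ 0#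
  orthonormal⇒independent (p@(_ , v) ∷ ps) (v-unit ∷ unit) (v⊥ ∷ orth) c comb≈0 = λ where
      zero    → c₀≈0
      (suc k) → orthonormal⇒independent ps unit orth (tail c) rest≈0 k
    where
    ⊥v : ∀ ps (c : V (length ps)) → All (Orthogonal p) ps → sum (λ k → c k * ⟨ vectors ps k , v ⟩) ≈ 0#
    ⊥v []             c []       = refl
    ⊥v ((_ , w) ∷ ps) c (⊥w ∷ ⊥) = trans (+-cong (trans (*-congˡ (trans (ip-comm w v) ⊥w)) (zeroʳ _)) (⊥v ps (tail c) ⊥)) (+-identityˡ 0#)
    c₀≈0 : c zero ≈ 0#
    c₀≈0 = begin
      c zero                                                      ≈⟨ *-identityʳ _ ⟨
      c zero * 1#                                                 ≈⟨ *-congˡ v-unit ⟨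
      c zero * ⟨ v , v ⟩                                          ≈⟨ +-identityʳ _ ⟨
      c zero * ⟨ v , v ⟩ + 0#                                     ≈⟨ +-congˡ (⊥v ps (tail c) v⊥) ⟨
      sum (λ k → c k * ⟨ vectors (p ∷ ps) k , v ⟩)                ≈⟨ ip-combination c (vectors (p ∷ ps)) v ⟨
      ⟨ combination c (vectors (p ∷ ps)) , v ⟩                    ≈⟨ ip-congʳ v comb≈0 ⟩
      ⟨ 𝟎 , v ⟩                                                   ≈⟨ ip-𝟎ˡ v ⟩
      0#                                                          ∎
    rest≈0 : combination (tail c) (vectors ps) ≋ 𝟎
    rest≈0 i = begin
      combination (tail c) (vectors ps) i                ≈⟨ +-identityˡ _ ⟨
      0# + combination (tail c) (vectors ps) i           ≈⟨ +-congʳ (trans (*-congʳ c₀≈0) (zeroˡ (v i))) ⟨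
      combination c (vectors (p ∷ ps)) i                 ≈⟨ comb≈0 i ⟩
      0#                                                 ∎

  module _ {m} {M : Matrix m} (symmetric : SymmetricMatrix M) (B : Eigenbasis (operator M)) where
    open Eigenbasis B

    private
      L : Operator m
      L = operator M
      sa : SelfAdjoint L
      sa = operator-selfAdjoint symmetric

    eigenvalues : List Carrier
    eigenvalues = map proj₁ pairs

    -- (λ − μ)⟨x,v⟩ = ⟨x,Lv⟩ − ⟨Lx,v⟩ = 0
    distinct-eigenvalues⇒orthogonal : ∀ {μ x} {p : Pair m} → L x ≋ μ • x → L (proj₂ p) ≋ proj₁ p • proj₂ p →
                                      ¬ (proj₁ p ≈ μ) → ⟨ x , proj₂ p ⟩ ≈ 0#
    distinct-eigenvalues⇒orthogonal {μ} {x} {κ , v} Lx≋μx Lv≋κv κ≉μ = no-zero-divisors diff≈0 κ-μ≉0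
      where
      κ-μ≉0 : ¬ (κ - μ ≈ 0#)
      κ-μ≉0 κ-μ≈0 = κ≉μ (trans (solve 2 (λ κ μ → κ := (κ :- μ) :+ μ) refl κ μ) (trans (+-congʳ κ-μ≈0) (+-identityˡ μ)))
      diff≈0 : (κ - μ) * ⟨ x , v ⟩ ≈ 0#
      diff≈0 = begin
        (κ - μ) * ⟨ x , v ⟩                  ≈⟨ solve 3 (λ κ μ p → (κ :- μ) :* p := κ :* p :- μ :* p) refl κ μ ⟨ x , v ⟩ ⟩
        κ * ⟨ x , v ⟩ - μ * ⟨ x , v ⟩        ≈⟨ +-cong (ip-•ʳ κ x v) (-‿cong (ip-•ˡ μ x v)) ⟨
        ⟨ x , κ • v ⟩ - ⟨ μ • x , v ⟩        ≈⟨ +-cong (ip-congˡ x Lv≋κv) (-‿cong (ip-congʳ v Lx≋μx)) ⟨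
        ⟨ x , L v ⟩ - ⟨ L x , v ⟩            ≈⟨ +-congʳ (adjoint sa x v) ⟨
        ⟨ L x , v ⟩ - ⟨ L x , v ⟩            ≈⟨ -‿inverseʳ _ ⟩
        0#                                   ∎

    -- In the expansion of a vector of the μ-eigenspace, the terms with other eigenvalues vanish by
    -- orthogonality, so the basis vectors with eigenvalue μ span it. For μ outside the spectrum the
    -- filtered list is empty and the argument is the same.
    spectrum : IsSpectrum M eigenvalues
    spectrum μ = ≡.subst (HasDimension (Eigenspace M μ)) (≡.sym (length-filter-map (_≟ μ) proj₁ pairs))
      (vectors F , record { member = member ; independent = independent ; spanning = spanning })
      where
      μ? : U.Decidable {A = Pair m} (λ p → proj₁ p ≈ μ)
      μ? p = proj₁ p ≟ μ
      F : List (Pair m)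
      F = filter μ? pairs
      member : ∀ k → Eigenspace M μ (vectors F k)
      member k i = trans (All.lookup (All.filter⁺ μ? eigen) (∈-lookup k) i) (*-congʳ (All.lookup (All.all-filter μ? pairs) (∈-lookup k)))
      independent : ∀ c → (∀ i → combination c (vectors F) i ≈ 0#) → ∀ k → c k ≈ 0#
      independent = orthonormal⇒independent F (All.filter⁺ μ? unit) (AllPairs.filter⁺ μ? orthogonal)
      spanning : ∀ v → Eigenspace M μ v → ∃[ c ] (∀ i → combination c (vectors F) i ≈ v i)
      spanning x Lx≋μx = (λ k → ⟨ x , vectors F k ⟩) , λ i → begin
        sum (λ k → ⟨ x , vectors F k ⟩ * vectors F k i)      ≈⟨ sum-cong-≋ (λ k → *-congˡ {⟨ x , vectors F k ⟩} (ip-e (vectors F k) i)) ⟨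
        ∑[ F ] summand x (e i)                               ≈⟨ ∑-filter μ? (summand x (e i)) pairs (off i) ⟩
        ∑[ pairs ] summand x (e i)                           ≈⟨ parseval x (e i) ⟩
        ⟨ x , e i ⟩                                          ≈⟨ ip-e x i ⟩
        x i                                                  ∎
        where
        off : ∀ i → All (λ p → ¬ (proj₁ p ≈ μ) → summand x (e i) p ≈ 0#) pairs
        off i = All.map (λ {p} Lv≋κv κ≉μ → trans
          (*-congʳ (distinct-eigenvalues⇒orthogonal {p = p} Lx≋μx Lv≋κv κ≉μ)) (zeroˡ _)) eigen

  module EigenvalueCount {m} {L : Operator m} (sa : SelfAdjoint L) (B : Eigenbasis L) where
    open Eigenbasis B

    Eigen : Pair m → Set
    Eigen (μ , v) = L v ≋ μ • v

    positive? : U.Decidable {A = Pair m} (λ p → 0# < proj₁ p)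
    positive? p = 0# <? proj₁ p

    zero? : U.Decidable {A = Pair m} (λ p → proj₁ p ≈ 0#)
    zero? p = proj₁ p ≟ 0#

    negative? : U.Decidable {A = Pair m} (λ p → proj₁ p < 0#)
    negative? p = proj₁ p <? 0#

    #positive #zero #negative : ℕ
    #positive = length (filter positive? pairs)
    #zero     = length (filter zero? pairs)
    #negative = length (filter negative? pairs)

    private
      count : ∀ (ps : List (Pair m)) →
        length (filter positive? ps) ℕ.+ length (filter negative? ps) ℕ.+ length (filter zero? ps) ≡ length ps
      count []       = ≡.refl
      count (p ∷ ps) with 0# <? proj₁ p | proj₁ p <? 0# | proj₁ p ≟ 0#
      ... | yes 0<μ | yes μ<0 | _       = ⊥-elim (<-asym 0<μ μ<0)
      ... | yes 0<μ | no _    | yes μ≈0 = ⊥-elim (positive⇒nonzero 0<μ μ≈0)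
      ... | yes _   | no _    | no _    = ≡.cong suc (count ps)
      ... | no _    | yes μ<0 | yes μ≈0 = ⊥-elim (<-irrefl μ≈0 μ<0)
      ... | no _    | yes _   | no _    = ≡.trans
        (≡.cong (ℕ._+ length (filter zero? ps)) (ℕ.+-suc (length (filter positive? ps)) (length (filter negative? ps))))
        (≡.cong suc (count ps))
      ... | no _    | no _    | yes _   = ≡.trans
        (ℕ.+-suc (length (filter positive? ps) ℕ.+ length (filter negative? ps)) (length (filter zero? ps)))
        (≡.cong suc (count ps))
      ... | no ¬pos | no ¬neg | no ¬zer with compare 0# (proj₁ p)
      ...   | tri< 0<μ _ _ = ⊥-elim (¬pos 0<μ)
      ...   | tri≈ _ 0≈μ _ = ⊥-elim (¬zer (sym 0≈μ))
      ...   | tri> _ _ μ<0 = ⊥-elim (¬neg μ<0)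

    counts-total : #positive ℕ.+ #negative ℕ.+ #zero ≡ m
    counts-total = ≡.trans (count pairs) size

    filter≡[]⇒none : ∀ {P : U.Pred (Pair m) 0ℓ} (P? : U.Decidable P) → filter P? pairs ≡ [] → All (¬_ ∘ P) pairs
    filter≡[]⇒none P? F≡[] = All.¬Any⇒All¬ pairs λ some → ℕ.<-irrefl (≡.cong length (≡.sym F≡[])) (filter-some P? some)

    ip-L : ∀ {κ v} x → L v ≋ κ • v → ⟨ L x , v ⟩ ≈ κ * ⟨ x , v ⟩
    ip-L {κ} {v} x Lv≋κv = trans (adjoint sa x v) (trans (ip-congˡ x Lv≋κv) (ip-•ʳ κ x v))

    form-eigenvector : ∀ {κ v} → L v ≋ κ • v → ⟨ v , v ⟩ ≈ 1# → form L v ≈ κ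
    form-eigenvector {v = v} Lv≋κv v-unit = trans (ip-L v Lv≋κv) (trans (*-congˡ v-unit) (*-identityʳ _))

    private
      ∑-nonpositive : ∀ {f : Pair m → Carrier} ps → All (λ p → 0# ≤ - f p) ps → 0# ≤ - (∑[ ps ] f)
      ∑-nonpositive []       []       = ≤-refl (sym -0#≈0#)
      ∑-nonpositive {f} (p ∷ ps) (f≤0 ∷ rest) = ≤-resp refl
        (solve 2 (λ a b → :- a :+ :- b := :- (a :+ b)) refl (f p) (∑[ ps ] f)) (0≤+0≤ f≤0 (∑-nonpositive ps rest))

    -- Parseval applied to L x and x writes the form as a sum of terms κ⟨x,v⟩².
    no-positive⇒form≤0 : All (λ p → ¬ (0# < proj₁ p)) pairs → ∀ x → form L x ≤ 0#
    no-positive⇒form≤0 none x 0<form = ≤-resp refl (-‿cong (parseval (L x) x)) (∑-nonpositive pairs terms)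
      (<-respˡ-≈ refl (0<-⇒<0 (<-respʳ-≈ (sym (-‿involutive _)) 0<form)))
      where
      terms : All (λ p → 0# ≤ - summand (L x) x p) pairs
      terms = All.zipWith (λ {p@(κ , v)} (κ≤0 , Lv≋κv) → ≤-resp refl (sym (begin
        - (⟨ L x , v ⟩ * ⟨ v , x ⟩)          ≈⟨ -‿cong (*-cong (ip-L x Lv≋κv) (ip-comm v x)) ⟩
        - (κ * ⟨ x , v ⟩ * ⟨ x , v ⟩)        ≈⟨ solve 2 (λ κ q → :- (κ :* q :* q) := (:0 :- κ) :* (q :* q)) refl κ ⟨ x , v ⟩ ⟩
        (0# - κ) * (⟨ x , v ⟩ * ⟨ x , v ⟩)   ∎)) (0≤*0≤ (≤⇒0≤- κ≤0) (0≤sq ⟨ x , v ⟩))) (none , eigen)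

    -- A suitable combination of two orthogonal eigenvectors lies in the hyperplane h^⊥.
    no-two-positive : ∀ {h} → (∀ x → ⟨ h , x ⟩ ≈ 0# → form L x ≤ 0#) →
      ∀ {p q} → Eigen p → Unit p → 0# < proj₁ p → Eigen q → Unit q → 0# < proj₁ q → Orthogonal p q → ⊥
    no-two-positive {h} hyperplane {κ , u} {μ , v} Lu≋κu u-unit 0<κ Lv≋μv v-unit 0<μ u⊥v =
      -- On αu - βv the form is κα² + μβ², which the hyperplane bound forces to be zero. Then β = 0,
      -- so u itself lies in the hyperplane, although its form is κ > 0.
      hyperplane u (sq≈0⇒≈0 β²≈0) (<-respʳ-≈ (sym (form-eigenvector Lu≋κu u-unit)) 0<κ)
      where
      α = ⟨ h , v ⟩
      β = ⟨ h , u ⟩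
      x = lin α u (- β) v
      hx≈0 : ⟨ h , x ⟩ ≈ 0#
      hx≈0 = trans (ip-linʳ α u (- β) v h) (solve 2 (λ α β → α :* β :+ :- β :* α := :0) refl α β)
      formx : form L x ≈ κ * (α * α) + μ * (β * β)
      formx = begin
        form L x
          ≈⟨ form-lin sa α u (- β) v ⟩
        α * α * form L u + 2# * (α * - β * ⟨ L u , v ⟩) + - β * - β * form L v
          ≈⟨ +-cong (+-cong (*-congˡ (form-eigenvector Lu≋κu u-unit)) (*-congˡ (*-congˡ Lu⊥v))) (*-congˡ (form-eigenvector Lv≋μv v-unit)) ⟩
        α * α * κ + 2# * (α * - β * 0#) + - β * - β * μ
          ≈⟨ solve 4 (λ α β κ μ → α :* α :* κ :+ :2 :* (α :* :- β :* :0) :+ :- β :* :- β :* μ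
               := κ :* (α :* α) :+ μ :* (β :* β)) refl α β κ μ ⟩
        κ * (α * α) + μ * (β * β) ∎
        where
        Lu⊥v : ⟨ L u , v ⟩ ≈ 0#
        Lu⊥v = trans (ip-L u Lv≋μv) (trans (*-congˡ u⊥v) (zeroʳ μ))
      0≤κα² : 0# ≤ κ * (α * α)
      0≤κα² = 0≤*0≤ (<⇒≤ 0<κ) (0≤sq α)
      0≤μβ² : 0# ≤ μ * (β * β)
      0≤μβ² = 0≤*0≤ (<⇒≤ 0<μ) (0≤sq β)
      formx≈0 : κ * (α * α) + μ * (β * β) ≈ 0#
      formx≈0 = ≤-antisym (≤-resp formx refl (hyperplane x hx≈0)) (0≤+0≤ 0≤κα² 0≤μβ²)
      β²≈0 : β * β ≈ 0#
      β²≈0 = no-zero-divisors (0≤+0≤≈0ʳ 0≤κα² 0≤μβ² formx≈0) (positive⇒nonzero 0<μ)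

    one-positive : ∀ h → (∃[ x ] 0# < form L x) → (∀ x → ⟨ h , x ⟩ ≈ 0# → form L x ≤ 0#) → #positive ≡ 1
    one-positive h (x , 0<form) hyperplane =
      go (filter positive? pairs) (filter≡[]⇒none positive?) (All.filter⁺ positive? eigen) (All.filter⁺ positive? unit)
         (All.all-filter positive? pairs) (AllPairs.filter⁺ positive? orthogonal)
      where
      -- The filtered list becomes a variable that can be matched on; the link to `pairs` survives
      -- as the consequence of its being empty.
      go : ∀ ps → (ps ≡ [] → All (λ p → ¬ (0# < proj₁ p)) pairs) → All Eigen ps → All Unit ps →
           All (λ p → 0# < proj₁ p) ps → AllPairs Orthogonal ps → length ps ≡ 1
      go []          none _ _ _ _ = ⊥-elim (no-positive⇒form≤0 (none ≡.refl) x 0<form)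
      go (p ∷ [])    _    _ _ _ _ = ≡.refl
      go (p ∷ q ∷ _) _ (p-eigen ∷ q-eigen ∷ _) (p-unit ∷ q-unit ∷ _) (0<p ∷ 0<q ∷ _) ((p⊥q ∷ _) ∷ _) =
        ⊥-elim (no-two-positive {h} hyperplane {p} {q} p-eigen p-unit 0<p q-eigen q-unit 0<q p⊥q)

    eigen-zero⇒kernel : ∀ {p : Pair m} → Eigen p → proj₁ p ≈ 0# → L (proj₂ p) ≋ 𝟎
    eigen-zero⇒kernel {_ , v} Lv≋κv κ≈0 i = trans (Lv≋κv i) (trans (*-congʳ κ≈0) (zeroˡ (v i)))

    no-zero : (∀ x → L x ≋ 𝟎 → x ≋ 𝟎) → #zero ≡ 0
    no-zero injective = go (filter zero? pairs) (All.filter⁺ zero? eigen) (All.filter⁺ zero? unit) (All.all-filter zero? pairs)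
      where
      go : ∀ ps → All Eigen ps → All Unit ps → All (λ p → proj₁ p ≈ 0#) ps → length ps ≡ 0
      go []            _ _ _ = ≡.refl
      go ((κ , v) ∷ _) (Lv≋κv ∷ _) (v-unit ∷ _) (κ≈0 ∷ _) = ⊥-elim (positive⇒nonzero 0<1 (trans (sym v-unit)
        (trans (ip-congʳ v (injective v (eigen-zero⇒kernel {κ , v} Lv≋κv κ≈0))) (ip-𝟎ˡ v))))

    one-zero : ∀ {k} → ¬ (k ≋ 𝟎) → L k ≋ 𝟎 → (∀ x → L x ≋ 𝟎 → ∃[ c ] x ≋ c • k) → #zero ≡ 1
    one-zero {k} k≉0 Lk≋0 kernel =
      go (filter zero? pairs) (filter≡[]⇒none zero?) (All.filter⁺ zero? eigen) (All.filter⁺ zero? unit)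
         (All.all-filter zero? pairs) (AllPairs.filter⁺ zero? orthogonal)
      where
      -- If no eigenvalue vanishes, k is orthogonal to the whole eigenbasis.
      none⇒⊥ : All (λ p → ¬ (proj₁ p ≈ 0#)) pairs → ⊥
      none⇒⊥ none = k≉0 (norm≈0⇒≋𝟎 k (trans (sym (parseval k k)) (vanish pairs (All.zipWith (λ {p} → term p) (none , eigen)))))
        where
        term : ∀ p → ¬ (proj₁ p ≈ 0#) × Eigen p → summand k k p ≈ 0#
        term (κ , v) (κ≉0 , Lv≋κv) = trans (*-congʳ (no-zero-divisors
          (trans (sym (ip-L k Lv≋κv)) (trans (ip-congʳ v Lk≋0) (ip-𝟎ˡ v))) κ≉0)) (zeroˡ _)
        vanish : ∀ ps → All (λ p → summand k k p ≈ 0#) ps → ∑[ ps ] summand k k ≈ 0#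
        vanish []       []       = refl
        vanish (p ∷ ps) (z ∷ zs) = trans (+-cong z (vanish ps zs)) (+-identityˡ 0#)
      -- The equality case of Cauchy-Schwarz: for multiples of one vector, ⟨u,u⟩⟨v,v⟩ = ⟨u,v⟩²,
      -- which here reads 1 = 0.
      parallel⇒⊥ : ∀ {u v} → ⟨ u , u ⟩ ≈ 1# → ⟨ v , v ⟩ ≈ 1# → ⟨ u , v ⟩ ≈ 0# → (∃[ c ] u ≋ c • k) → (∃[ d ] v ≋ d • k) → ⊥
      parallel⇒⊥ {u} {v} u-unit v-unit u⊥v (c , u≋ck) (d , v≋dk) = positive⇒nonzero 0<1 (begin
        1#                                       ≈⟨ *-identityˡ 1# ⟨
        1# * 1#                                  ≈⟨ *-cong u-unit v-unit ⟨
        ⟨ u , u ⟩ * ⟨ v , v ⟩                    ≈⟨ *-cong (ip u≋ck u≋ck) (ip v≋dk v≋dk) ⟩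
        c * (c * n) * (d * (d * n))              ≈⟨ solve 3 (λ c d n → c :* (c :* n) :* (d :* (d :* n)) := c :* (d :* n) :* (c :* (d :* n))) refl c d n ⟩
        c * (d * n) * (c * (d * n))              ≈⟨ *-congʳ (trans (sym (ip u≋ck v≋dk)) u⊥v) ⟩
        0# * (c * (d * n))                       ≈⟨ zeroˡ _ ⟩
        0#                                       ∎)
        where
        n = ⟨ k , k ⟩
        ip : ∀ {x y a b} → x ≋ a • k → y ≋ b • k → ⟨ x , y ⟩ ≈ a * (b * n)
        ip {a = a} {b} x≋ y≋ = trans (ip-cong x≋ y≋) (trans (ip-•ˡ a k (b • k)) (*-congˡ (ip-•ʳ b k k)))
      go : ∀ ps → (ps ≡ [] → All (λ p → ¬ (proj₁ p ≈ 0#)) pairs) → All Eigen ps → All Unit ps →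
           All (λ p → proj₁ p ≈ 0#) ps → AllPairs Orthogonal ps → length ps ≡ 1
      go []          none _ _ _ _ = ⊥-elim (none⇒⊥ (none ≡.refl))
      go (p ∷ [])    _    _ _ _ _ = ≡.refl
      go (p@(κ , u) ∷ q@(μ , v) ∷ _) _ (Lu ∷ Lv ∷ _) (u-unit ∷ v-unit ∷ _) (κ≈0 ∷ μ≈0 ∷ _) ((u⊥v ∷ _) ∷ _) =
        ⊥-elim (parallel⇒⊥ u-unit v-unit u⊥v (kernel u (eigen-zero⇒kernel {p} Lu κ≈0)) (kernel v (eigen-zero⇒kernel {q} Lv μ≈0)))

  -- The three counts add up to the order of the matrix, so two of them determine the number of
  -- negative eigenvalues. The counts are asked of an arbitrary eigenbasis, since the constructed
  -- one is never inspected.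
  inertia : ∀ {m} {M : Matrix m} → SymmetricMatrix M → ∀ {i₀ i₋} →
    ((sa : SelfAdjoint (operator M)) (B : Eigenbasis (operator M)) →
      let open EigenvalueCount sa B in #positive ≡ 1 × #zero ≡ i₀) →
    1 ℕ.+ i₋ ℕ.+ i₀ ≡ m → HasInertia M (1 , i₋ , i₀)
  inertia {m} {M} symmetric {i₀} {i₋} counts total = from-eigenbasis (eigenbasis (operator-selfAdjoint symmetric))
    where
    from-eigenbasis : Eigenbasis (operator M) → HasInertia M (1 , i₋ , i₀)
    from-eigenbasis B = symmetric , eigenvalues symmetric B , spectrum symmetric B ,
      ≡.trans (length-filter-map (0# <?_) proj₁ pairs) one ,
      ≡.trans (length-filter-map (_<? 0#) proj₁ pairs) negative ,
      ≡.trans (length-filter-map (_≟ 0#) proj₁ pairs) zeros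
      where
      open Eigenbasis B
      open EigenvalueCount (operator-selfAdjoint symmetric) B
      one : #positive ≡ 1
      one = proj₁ (counts (operator-selfAdjoint symmetric) B)
      zeros : #zero ≡ i₀
      zeros = proj₂ (counts (operator-selfAdjoint symmetric) B)
      negative : #negative ≡ i₋
      negative = ℕ.suc-injective (ℕ.+-cancelʳ-≡ i₀ _ _ (≡.trans (≡.cong₂ (λ a b → a ℕ.+ #negative ℕ.+ b) (≡.sym one) (≡.sym zeros))
        (≡.trans counts-total (≡.sym total))))

-- Distances in the helm graph.

module HelmGraph where

  open ≡ using (refl; sym; trans; cong; subst; subst₂)
  open import Data.Nat using (_+_; _≤_)

  -- The cyclic predecessor. Built from `fromℕ` and `inject₁`, it matches the splitting of a sum
  -- into initial part and last term, so sums reindex along it at once.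
  prev : ∀ {M} → Fin (suc M) → Fin (suc M)
  prev zero    = fromℕ _
  prev (suc i) = inject₁ i

  prev-cyclicSuc : ∀ {M} (i : Fin (suc M)) → CyclicSuc (prev i) i
  prev-cyclicSuc zero    = inj₂ (cong suc (Fin.toℕ-fromℕ _) , refl)
  prev-cyclicSuc (suc i) = inj₁ (cong suc (sym (Fin.toℕ-inject₁ i)))

  cyclicSuc⇒≡prev : ∀ {M} {i j : Fin (suc M)} → CyclicSuc i j → i ≡ prev j
  cyclicSuc⇒≡prev {j = suc j} (inj₁ eq)       = Fin.toℕ-injective (trans (sym (ℕ.suc-injective eq)) (sym (Fin.toℕ-inject₁ j)))
  cyclicSuc⇒≡prev {j = zero}  (inj₂ (eq , _)) = Fin.toℕ-injective (trans (ℕ.suc-injective eq) (sym (Fin.toℕ-fromℕ _)))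

  prev≢id : ∀ {M} (i : Fin (2 + M)) → ¬ (prev i ≡ i)
  prev≢id zero    ()
  prev≢id (suc i) eq = ℕ.1+n≢n (trans (sym (cong toℕ eq)) (Fin.toℕ-inject₁ i))

  -- A cycle of length at least three: the two rim neighbours of a vertex differ, so off-diagonal
  -- entries of the circulant never reach 2.
  prev²≢id : ∀ {M} (i : Fin (3 + M)) → ¬ (prev (prev i) ≡ i)
  prev²≢id zero          ()
  prev²≢id (suc zero)    ()
  prev²≢id (suc (suc i)) eq = ℕ.m+1+n≢n 1 (trans (sym (cong toℕ eq)) (trans (Fin.toℕ-inject₁ (inject₁ i)) (Fin.toℕ-inject₁ i)))

  module HelmDistance (M : ℕ) where

    N : ℕ
    N = suc M

    Vertex : Set
    Vertex = HelmVertex N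

    -- The value 2 is the detour through the hub, available to every pair.
    rimDistance : Fin N → Fin N → ℕ
    rimDistance i j with i ≟ᶠ j | i ≟ᶠ prev j | j ≟ᶠ prev i
    ... | yes _ | _     | _     = 0
    ... | no _  | yes _ | _     = 1
    ... | no _  | no _  | yes _ = 1
    ... | no _  | no _  | no _  = 2

    -- With the decision as an argument, proofs can split on it without disturbing the same
    -- comparison inside `rimDistance`.
    unlessEqual : ∀ {i j : Fin N} → Dec (i ≡ j) → ℕ → ℕ
    unlessEqual (yes _) d = 0
    unlessEqual (no _)  d = d

    pendantDistance : Fin N → Fin N → ℕ
    pendantDistance i j = unlessEqual (i ≟ᶠ j) (2 + rimDistance i j)

    distance : Vertex → Vertex → ℕ
    distance hub         hub         = 0
    distance hub         (rim _)     = 1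
    distance hub         (pendant _) = 2
    distance (rim _)     hub         = 1
    distance (pendant _) hub         = 2
    distance (rim i)     (rim j)     = rimDistance i j
    distance (rim i)     (pendant j) = 1 + rimDistance i j
    distance (pendant i) (rim j)     = 1 + rimDistance i j
    distance (pendant i) (pendant j) = pendantDistance i j

    rimDistance-sym : ∀ i j → rimDistance i j ≡ rimDistance j i
    rimDistance-sym i j with i ≟ᶠ j | j ≟ᶠ i | i ≟ᶠ prev j | j ≟ᶠ prev i
    ... | yes _  | yes _  | _     | _     = refl
    ... | yes eq | no neq | _     | _     = ⊥-elim (neq (sym eq))
    ... | no neq | yes eq | _     | _     = ⊥-elim (neq (sym eq))
    ... | no _   | no _   | yes _ | yes _ = refl
    ... | no _   | no _   | yes _ | no _  = refl
    ... | no _   | no _   | no _  | yes _ = refl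
    ... | no _   | no _   | no _  | no _  = refl

    pendantDistance-sym : ∀ i j → pendantDistance i j ≡ pendantDistance j i
    pendantDistance-sym i j = trans (cong (λ d → unlessEqual (i ≟ᶠ j) (2 + d)) (rimDistance-sym i j)) (cases (i ≟ᶠ j) (j ≟ᶠ i))
      where
      cases : ∀ {d} (i≟j : Dec (i ≡ j)) (j≟i : Dec (j ≡ i)) → unlessEqual i≟j d ≡ unlessEqual j≟i d
      cases (yes _)  (yes _)  = refl
      cases (yes eq) (no neq) = ⊥-elim (neq (sym eq))
      cases (no neq) (yes eq) = ⊥-elim (neq (sym eq))
      cases (no _)   (no _)   = refl

    distance-sym : ∀ U V → distance U V ≡ distance V U
    distance-sym hub         hub         = refl
    distance-sym hub         (rim _)     = refl
    distance-sym hub         (pendant _) = refl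
    distance-sym (rim _)     hub         = refl
    distance-sym (pendant _) hub         = refl
    distance-sym (rim i)     (rim j)     = rimDistance-sym i j
    distance-sym (rim i)     (pendant j) = cong suc (rimDistance-sym i j)
    distance-sym (pendant i) (rim j)     = cong suc (rimDistance-sym i j)
    distance-sym (pendant i) (pendant j) = pendantDistance-sym i j

    rimDistance-refl : ∀ i → rimDistance i i ≡ 0
    rimDistance-refl i with i ≟ᶠ i
    ... | yes _  = refl
    ... | no neq = ⊥-elim (neq refl)

    distance-refl : ∀ V → distance V V ≡ 0
    distance-refl hub     = refl
    distance-refl (rim i) = rimDistance-refl i
    distance-refl (pendant i) with i ≟ᶠ i
    ... | yes _  = refl
    ... | no neq = ⊥-elim (neq refl)

    rimDistance≤2 : ∀ i j → rimDistance i j ≤ 2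
    rimDistance≤2 i j with i ≟ᶠ j | i ≟ᶠ prev j | j ≟ᶠ prev i
    ... | yes _ | _     | _     = z≤n
    ... | no _  | yes _ | _     = s≤s z≤n
    ... | no _  | no _  | yes _ = s≤s z≤n
    ... | no _  | no _  | no _  = ℕ.≤-refl

    rimDistance-prev : ∀ i → rimDistance (prev i) i ≤ 1
    rimDistance-prev i with prev i ≟ᶠ i | prev i ≟ᶠ prev i
    ... | yes _ | _      = z≤n
    ... | no _  | yes _  = ℕ.≤-refl
    ... | no _  | no neq = ⊥-elim (neq refl)

    rimDistance-positive : ∀ {i j} → ¬ (i ≡ j) → 1 ≤ rimDistance i j
    rimDistance-positive {i} {j} i≢j with i ≟ᶠ j | i ≟ᶠ prev j | j ≟ᶠ prev i
    ... | yes eq | _     | _     = ⊥-elim (i≢j eq)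
    ... | no _   | yes _ | _     = ℕ.≤-refl
    ... | no _   | no _  | yes _ = ℕ.≤-refl
    ... | no _   | no _  | no _  = s≤s z≤n

    -- Sizes alone decide: for j ≠ k the right side is at least 2, the largest rim distance.
    rimDistance-step : ∀ {i j} k → rimDistance i j ≤ 1 → rimDistance i k ≤ suc (rimDistance j k)
    rimDistance-step {i} {j} k ij≤1 = cases (j ≟ᶠ k)
      where
      cases : Dec (j ≡ k) → rimDistance i k ≤ suc (rimDistance j k)
      cases (yes refl) = ℕ.≤-trans ij≤1 (s≤s z≤n)
      cases (no j≢k)   = ℕ.≤-trans (rimDistance≤2 i k) (s≤s (rimDistance-positive j≢k))

    pendant-step : ∀ i k → suc (rimDistance i k) ≤ suc (pendantDistance i k)
    pendant-step i k = cases (i ≟ᶠ k)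
      where
      cases : (i≟k : Dec (i ≡ k)) → suc (rimDistance i k) ≤ suc (unlessEqual i≟k (2 + rimDistance i k))
      cases (yes refl) = ℕ.≤-reflexive (cong suc (rimDistance-refl i))
      cases (no _)     = s≤s (ℕ.m≤n+m _ 2)

    step-pendant : ∀ i k → pendantDistance i k ≤ 2 + rimDistance i k
    step-pendant i k = cases (i ≟ᶠ k)
      where
      cases : (i≟k : Dec (i ≡ k)) → unlessEqual i≟k (2 + rimDistance i k) ≤ 2 + rimDistance i k
      cases (yes _) = z≤n
      cases (no _)  = ℕ.≤-refl

    rim-rim-step : ∀ {i j} W → rimDistance i j ≤ 1 → distance (rim i) W ≤ suc (distance (rim j) W)
    rim-rim-step hub         ij≤1 = s≤s z≤n
    rim-rim-step (rim k)     ij≤1 = rimDistance-step k ij≤1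
    rim-rim-step (pendant k) ij≤1 = s≤s (rimDistance-step k ij≤1)

    cyclicSuc⇒≤1 : ∀ {i j} → CyclicSuc i j → rimDistance i j ≤ 1
    cyclicSuc⇒≤1 {i} {j} i→j = subst (λ k → rimDistance k j ≤ 1) (sym (cyclicSuc⇒≡prev i→j)) (rimDistance-prev j)

    -- Distance to a fixed vertex drops by at most one per edge; induction along a walk turns this
    -- into the lower bound on its length.
    distance-step : ∀ {U V} W → HelmAdj N U V → distance U W ≤ suc (distance V W)
    distance-step hub         (fwd (spoke i))   = z≤n
    distance-step (rim k)     (fwd (spoke i))   = s≤s z≤n
    distance-step (pendant k) (fwd (spoke i))   = s≤s (s≤s z≤n)
    distance-step hub         (bwd (spoke i))   = ℕ.≤-refl
    distance-step (rim k)     (bwd (spoke i))   = rimDistance≤2 i k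
    distance-step (pendant k) (bwd (spoke i))   = s≤s (rimDistance≤2 i k)
    distance-step hub         (fwd (leaf i))    = s≤s z≤n
    distance-step (rim k)     (fwd (leaf i))    = ℕ.m≤n+m _ 2
    distance-step (pendant k) (fwd (leaf i))    = pendant-step i k
    distance-step hub         (bwd (leaf i))    = ℕ.≤-refl
    distance-step (rim k)     (bwd (leaf i))    = ℕ.≤-refl
    distance-step (pendant k) (bwd (leaf i))    = step-pendant i k
    distance-step W           (fwd (cycle i→j)) = rim-rim-step W (cyclicSuc⇒≤1 i→j)
    distance-step W           (bwd (cycle {i} {j} i→j)) = rim-rim-step W (subst (_≤ 1) (rimDistance-sym i j) (cyclicSuc⇒≤1 i→j))

    index : Vertex → Fin (1 + (N + N))
    index hub         = zero
    index (rim i)     = suc (i ↑ˡ N)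
    index (pendant i) = suc (N ↑ʳ i)

    helmVertex-index : ∀ V → helmVertex N (index V) ≡ V
    helmVertex-index hub         = refl
    helmVertex-index (rim i)     = cong [ rim , pendant ]′ (Fin.splitAt-↑ˡ N i N)
    helmVertex-index (pendant i) = cong [ rim , pendant ]′ (Fin.splitAt-↑ʳ N N i)

    index-helmVertex : ∀ u → index (helmVertex N u) ≡ u
    index-helmVertex zero    = refl
    index-helmVertex (suc u) with splitAt N u in eq
    ... | inj₁ i = cong suc (Fin.splitAt⁻¹-↑ˡ eq)
    ... | inj₂ i = cong suc (Fin.splitAt⁻¹-↑ʳ eq)

    dist : Fin (1 + (N + N)) → Fin (1 + (N + N)) → ℕ
    dist u v = distance (helmVertex N u) (helmVertex N v)

    dist-sym : ∀ u v → dist u v ≡ dist v u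
    dist-sym u v = distance-sym (helmVertex N u) (helmVertex N v)

    -- The graph enters through an equation for its adjacency, which for `helm n 4≤n` becomes `refl`
    -- once n is matched as 4 + k.
    module _ (G : SimpleGraph (1 + (N + N))) (Adj-def : SimpleGraph.Adj G ≡ (HelmAdj N on helmVertex N)) where

      open SimpleGraph G

      adjacent : ∀ {U V} → HelmAdj N U V → Adj (index U) (index V)
      adjacent {U} {V} UV rewrite Adj-def = subst₂ (HelmAdj N) (sym (helmVertex-index U)) (sym (helmVertex-index V)) UV

      snoc : ∀ {u v w k} → Walk G u v k → Adj v w → Walk G u w (suc k)
      snoc []      vw = vw ∷ []
      snoc (e ∷ p) vw = e ∷ snoc p vw

      up : ∀ i → Adj (index (pendant i)) (index (rim i))
      up i = adjacent (bwd (leaf i))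

      down : ∀ i → Adj (index (rim i)) (index (pendant i))
      down i = adjacent (fwd (leaf i))

      rim-walk : ∀ i j → Walk G (index (rim i)) (index (rim j)) (rimDistance i j)
      rim-walk i j with i ≟ᶠ j | i ≟ᶠ prev j | j ≟ᶠ prev i
      ... | yes refl | _        | _        = []
      ... | no _     | yes refl | _        = adjacent (fwd (cycle (prev-cyclicSuc j))) ∷ []
      ... | no _     | no _     | yes refl = adjacent (bwd (cycle (prev-cyclicSuc i))) ∷ []
      ... | no _     | no _     | no _     = adjacent (bwd (spoke i)) ∷ (adjacent (fwd (spoke j)) ∷ [])

      pendant-walk : ∀ i j → Walk G (index (pendant i)) (index (pendant j)) (pendantDistance i j)
      pendant-walk i j = cases (i ≟ᶠ j)
        where
        cases : (i≟j : Dec (i ≡ j)) → Walk G (index (pendant i)) (index (pendant j)) (unlessEqual i≟j (2 + rimDistance i j))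
        cases (yes refl) = []
        cases (no _)     = up i ∷ snoc (rim-walk i j) (down j)

      shortest-walk : ∀ U V → Walk G (index U) (index V) (distance U V)
      shortest-walk hub         hub         = []
      shortest-walk hub         (rim j)     = adjacent (fwd (spoke j)) ∷ []
      shortest-walk hub         (pendant j) = adjacent (fwd (spoke j)) ∷ (down j ∷ [])
      shortest-walk (rim i)     hub         = adjacent (bwd (spoke i)) ∷ []
      shortest-walk (pendant i) hub         = up i ∷ (adjacent (bwd (spoke i)) ∷ [])
      shortest-walk (rim i)     (rim j)     = rim-walk i j
      shortest-walk (rim i)     (pendant j) = snoc (rim-walk i j) (down j)
      shortest-walk (pendant i) (rim j)     = up i ∷ rim-walk i j
      shortest-walk (pendant i) (pendant j) = pendant-walk i j

      minimal : ∀ {u v k} → Walk G u v k → dist u v ≤ k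
      minimal {u} []                            = ℕ.≤-reflexive (distance-refl (helmVertex N u))
      minimal {u} {w} (_∷_ {v = v} uv walk) =
        ℕ.≤-trans (distance-step (helmVertex N w) (subst (λ R → R u v) Adj-def uv)) (s≤s (minimal walk))

      distanceMatrix : DistanceMatrix G
      distanceMatrix = record
        { dist    = dist
        ; walk    = λ u v → subst₂ (λ a b → Walk G a b (dist u v)) (index-helmVertex u) (index-helmVertex v)
                              (shortest-walk (helmVertex N u) (helmVertex N v))
        ; minimal = minimal
        }

open HelmGraph

even-total : ∀ k → 1 ℕ.+ (2 ℕ.* (4 ℕ.+ k) ℕ.∸ 2) ℕ.+ 0 ≡ 1 ℕ.+ ((3 ℕ.+ k) ℕ.+ (3 ℕ.+ k))
-- The truncated subtraction computes away, 2 · (4 + k) ∸ 2 being 2 + k + (4 + k + 0), and leaves a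
-- semiring identity.
even-total = solve 1 (λ k → con 1 :+ (con 2 :+ k :+ (con 4 :+ k :+ con 0)) :+ con 0 := con 1 :+ ((con 3 :+ k) :+ (con 3 :+ k))) ≡.refl
  where open Data.Nat.Solver.+-*-Solver

odd-total : ∀ k → 1 ℕ.+ (2 ℕ.* (4 ℕ.+ k) ℕ.∸ 3) ℕ.+ 1 ≡ 1 ℕ.+ ((3 ℕ.+ k) ℕ.+ (3 ℕ.+ k))
odd-total = solve 1 (λ k → con 1 :+ (con 1 :+ k :+ (con 4 :+ k :+ con 0)) :+ con 1 := con 1 :+ ((con 3 :+ k) :+ (con 3 :+ k))) ≡.refl
  where open Data.Nat.Solver.+-*-Solver

-- The distance matrix as an operator, with n = 4 + k and rim length N = 3 + k.

module HelmMatrix (ℝ : Reals) (k : ℕ) where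

  open OrderedField ℝ
  open InnerProduct ℝ
  open SelfAdjointOperator ℝ
  open SpectralTheorem ℝ
  open MatrixSpectrum ℝ
  open Inertia ℝ
  open HelmDistance (2 ℕ.+ k) using
    ( N; Vertex; rimDistance; rimDistance-refl; unlessEqual; pendantDistance; distance
    ; index; helmVertex-index; index-helmVertex; dist; dist-sym )
  open Algebra.Properties.Semiring.Mult semiring using () renaming (_×_ to _·_)
  open ≈-Reasoning

  cast : ℕ → Carrier
  cast d = d · 1#

  D : Matrix (1 ℕ.+ (N ℕ.+ N))
  D = fromNatMatrix dist

  L : Operator (1 ℕ.+ (N ℕ.+ N))
  L = operator D

  D-symmetric : SymmetricMatrix D
  D-symmetric i j = reflexive (≡.cong cast (dist-sym i j))

  L-selfAdjoint : SelfAdjoint L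
  L-selfAdjoint = operator-selfAdjoint D-symmetric

  hubPart : V (1 ℕ.+ (N ℕ.+ N)) → Carrier
  hubPart x = x (index hub)

  rimPart pendantPart : V (1 ℕ.+ (N ℕ.+ N)) → V N
  rimPart x i     = x (index (rim i))
  pendantPart x i = x (index (pendant i))

  sum-split : ∀ {m n} (f : V (m ℕ.+ n)) → sum f ≈ sum (λ i → f (i ↑ˡ n)) + sum (λ i → f (m ↑ʳ i))
  sum-split {zero}  f = sym (+-identityˡ _)
  sum-split {suc m} f = trans (+-congˡ (sum-split {m} (λ i → f (suc i)))) (sym (+-assoc _ _ _))

  sum-vertices : ∀ (f : V (1 ℕ.+ (N ℕ.+ N))) → sum f ≈ hubPart f + (sum (rimPart f) + sum (pendantPart f))
  sum-vertices f = +-congˡ (sum-split {N} (λ i → f (suc i)))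

  vertex-cases : ∀ {P : Fin (1 ℕ.+ (N ℕ.+ N)) → Set} →
    P (index hub) → (∀ i → P (index (rim i))) → (∀ i → P (index (pendant i))) → ∀ u → P u
  vertex-cases {P} h r p u = ≡.subst P (index-helmVertex u) (at (helmVertex N u))
    where
    at : ∀ U → P (index U)
    at hub         = h
    at (rim i)     = r i
    at (pendant i) = p i

  L-row : ∀ x U → L x (index U) ≈ cast (distance U hub) * hubPart x +
    (⟨ (λ j → cast (distance U (rim j))) , rimPart x ⟩ + ⟨ (λ j → cast (distance U (pendant j))) , pendantPart x ⟩)
  L-row x U = begin
    L x (index U)
      ≈⟨ sum-vertices (λ v → D (index U) v * x v) ⟩
    D (index U) (index hub) * hubPart x + (⟨ rimPart (D (index U)) , rimPart x ⟩ + ⟨ pendantPart (D (index U)) , pendantPart x ⟩)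
      ≈⟨ +-cong (*-congʳ (entry hub)) (+-cong (ip-congʳ (rimPart x) (λ j → entry (rim j))) (ip-congʳ (pendantPart x) (λ j → entry (pendant j)))) ⟩
    _ ∎
    where
    entry : ∀ W → D (index U) (index W) ≈ cast (distance U W)
    entry W = reflexive (≡.cong₂ (λ A B → cast (distance A B)) (helmVertex-index U) (helmVertex-index W))

  𝟏 : ∀ {m} → V m
  𝟏 _ = 1#

  e-same : ∀ {m} (i : Fin m) → e i i ≈ 1#
  e-same zero    = refl
  e-same (suc i) = e-same i

  e-diff : ∀ {m} {i j : Fin m} → ¬ (i ≡ j) → e i j ≈ 0#
  e-diff {i = zero}  {zero}  i≢j = ⊥-elim (i≢j ≡.refl)
  e-diff {i = zero}  {suc j} i≢j = refl
  e-diff {i = suc i} {zero}  i≢j = refl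
  e-diff {i = suc i} {suc j} i≢j = e-diff {i = i} {j} (λ i≡j → i≢j (≡.cong suc i≡j))

  e-sym : ∀ {m} (i j : Fin m) → e i j ≈ e j i
  e-sym i j with i ≟ᶠ j
  ... | yes ≡.refl = refl
  ... | no i≢j     = trans (e-diff i≢j) (sym (e-diff (λ j≡i → i≢j (≡.sym j≡i))))

  sum-prev : ∀ {m} (f : V (suc m)) → sum (λ i → f (prev i)) ≈ sum f
  sum-prev f = trans (+-comm _ _) (sym (sum-init-last f))

  rimRow : Fin N → V N
  rimRow i j = cast (rimDistance i j)

  -- The last summand marks the successor of i, expressed as the j with `prev j` equal to i.
  cyclicRow : Fin N → V N
  cyclicRow i = lin 1# (lin 2# (e i) 1# (e (prev i))) 1# (λ j → e (prev j) i)

  -- The paper's D(H_n) is written with the circulant S whose i-th row is cyclicRow i.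
  rimRow-decomposition : ∀ i → rimRow i ≋ lin 2# 𝟏 (- 1#) (cyclicRow i)
  rimRow-decomposition i j with i ≟ᶠ j | i ≟ᶠ prev j | j ≟ᶠ prev i
  ... | yes ≡.refl | _ | _ = sym (trans
    (entry (e-same i) (e-diff (prev≢id i)) (e-diff (prev≢id i)))
    (solve 0 (:2 :* :1 :+ :- :1 :* (:1 :* (:2 :* :1 :+ :1 :* :0) :+ :1 :* :0) := :0) refl))
    where
    entry : ∀ {a b c} → e i i ≈ a → e (prev i) i ≈ b → e (prev i) i ≈ c →
            lin 2# 𝟏 (- 1#) (cyclicRow i) i ≈ 2# * 1# + - 1# * (1# * (2# * a + 1# * b) + 1# * c)
    entry a b c = +-congˡ (*-congˡ (+-cong (*-congˡ (+-cong (*-congˡ a) (*-congˡ b))) (*-congˡ c)))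
  ... | no i≢j | yes ≡.refl | _ = sym (trans
    (+-congˡ (*-congˡ (+-cong (*-congˡ (+-cong (*-congˡ (e-diff i≢j)) (*-congˡ (e-diff (prev²≢id j))))) (*-congˡ (e-same (prev j))))))
    (solve 0 (:2 :* :1 :+ :- :1 :* (:1 :* (:2 :* :0 :+ :1 :* :0) :+ :1 :* :1) := :1 :+ :0) refl))
  ... | no i≢j | no i≢pj | yes ≡.refl = sym (trans
    (+-congˡ (*-congˡ (+-cong (*-congˡ (+-cong (*-congˡ (e-diff i≢j)) (*-congˡ (e-same (prev i)))))
      (*-congˡ (e-diff (λ eq → i≢pj (≡.sym eq)))))))
    (solve 0 (:2 :* :1 :+ :- :1 :* (:1 :* (:2 :* :0 :+ :1 :* :1) :+ :1 :* :0) := :1 :+ :0) refl))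
  ... | no i≢j | no i≢pj | no j≢pi = sym (trans
    (+-congˡ (*-congˡ (+-cong (*-congˡ (+-cong (*-congˡ (e-diff i≢j)) (*-congˡ (e-diff (λ eq → j≢pi (≡.sym eq))))))
      (*-congˡ (e-diff (λ eq → i≢pj (≡.sym eq)))))))
    (solve 0 (:2 :* :1 :+ :- :1 :* (:1 :* (:2 :* :0 :+ :1 :* :0) :+ :1 :* :0) := :1 :+ (:1 :+ :0)) refl))

  -- Twice the identity plus the adjacency matrix of the rim: the signless Laplacian of a cycle.
  S : Operator N
  S w i = ⟨ cyclicRow i , w ⟩

  rim-ip : ∀ i w → ⟨ rimRow i , w ⟩ ≈ 2# * ⟨ 𝟏 , w ⟩ - S w i
  rim-ip i w = trans (trans (ip-congʳ w (rimRow-decomposition i)) (ip-linˡ 2# 𝟏 (- 1#) (cyclicRow i) w))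
    (solve 2 (λ p s → p :+ :- :1 :* s := p :- s) refl (2# * ⟨ 𝟏 , w ⟩) (S w i))

  suc-rim-ip : ∀ i w → ⟨ (λ j → cast (suc (rimDistance i j))) , w ⟩ ≈ ⟨ 𝟏 , w ⟩ + (2# * ⟨ 𝟏 , w ⟩ - S w i)
  suc-rim-ip i w = begin
    ⟨ (λ j → 1# + rimRow i j) , w ⟩                ≈⟨ ip-congʳ w (λ j → +-cong (*-identityˡ 1#) (*-identityˡ (rimRow i j))) ⟨
    ⟨ lin 1# 𝟏 1# (rimRow i) , w ⟩                 ≈⟨ ip-linˡ 1# 𝟏 1# (rimRow i) w ⟩
    1# * ⟨ 𝟏 , w ⟩ + 1# * ⟨ rimRow i , w ⟩         ≈⟨ +-cong (*-identityˡ _) (trans (*-identityˡ _) (rim-ip i w)) ⟩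
    ⟨ 𝟏 , w ⟩ + (2# * ⟨ 𝟏 , w ⟩ - S w i)           ∎

  -- Going down and up again would make the diagonal 2 instead of 0. The correcting term -2wᵢ is
  -- what later forces the pendant part of a kernel vector to vanish.
  pendant-ip : ∀ i w → ⟨ (λ j → cast (pendantDistance i j)) , w ⟩ ≈ 2# * ⟨ 𝟏 , w ⟩ + (2# * ⟨ 𝟏 , w ⟩ - S w i) - 2# * w i
  pendant-ip i w = begin
    ⟨ (λ j → cast (pendantDistance i j)) , w ⟩
      ≈⟨ ip-congʳ w (λ j → entry j (i ≟ᶠ j)) ⟩
    ⟨ lin 1# (lin 2# 𝟏 1# (rimRow i)) (- 2#) (e i) , w ⟩
      ≈⟨ trans (ip-linˡ 1# (lin 2# 𝟏 1# (rimRow i)) (- 2#) (e i) w)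
           (+-cong (*-congˡ (ip-linˡ 2# 𝟏 1# (rimRow i) w)) (*-congˡ (trans (ip-comm (e i) w) (ip-e w i)))) ⟩
    1# * (2# * ⟨ 𝟏 , w ⟩ + 1# * ⟨ rimRow i , w ⟩) + - 2# * w i
      ≈⟨ +-congʳ (*-congˡ (+-congˡ (*-congˡ (rim-ip i w)))) ⟩
    1# * (2# * ⟨ 𝟏 , w ⟩ + 1# * (2# * ⟨ 𝟏 , w ⟩ - S w i)) + - 2# * w i
      ≈⟨ solve 3 (λ p s w →
           :1 :* (:2 :* p :+ :1 :* (:2 :* p :- s)) :+ :- :2 :* w := :2 :* p :+ (:2 :* p :- s) :- :2 :* w) refl ⟨ 𝟏 , w ⟩ (S w i) (w i) ⟩
    2# * ⟨ 𝟏 , w ⟩ + (2# * ⟨ 𝟏 , w ⟩ - S w i) - 2# * w i ∎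
    where
    entry : ∀ j (i≟j : Dec (i ≡ j)) → cast (unlessEqual i≟j (2 ℕ.+ rimDistance i j)) ≈ lin 1# (lin 2# 𝟏 1# (rimRow i)) (- 2#) (e i) j
    entry j (yes ≡.refl) = sym (trans
      (+-cong (*-congˡ (+-congˡ (*-congˡ (reflexive (≡.cong cast (rimDistance-refl i)))))) (*-congˡ (e-same i)))
      (solve 0 (:1 :* (:2 :* :1 :+ :1 :* :0) :+ :- :2 :* :1 := :0) refl))
    entry j (no i≢j) = sym (trans
      (+-congˡ (*-congˡ (e-diff i≢j)))
      (solve 1 (λ r →
        :1 :* (:2 :* :1 :+ :1 :* r) :+ :- :2 :* :0 := :1 :+ (:1 :+ r)) refl (rimRow i j)))

  const-ip : ∀ {m} c (w : V m) → ⟨ (λ _ → c) , w ⟩ ≈ c * ⟨ 𝟏 , w ⟩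
  const-ip c w = trans (ip-congʳ w (λ _ → sym (*-identityʳ c))) (ip-•ˡ c 𝟏 w)

  -- The transpose of the shift w ∘ prev, so it reads the value at the successor.
  T : Operator N
  T w i = ⟨ (λ j → e (prev j) i) , w ⟩

  S-expand : ∀ w → S w ≋ lin 1# (lin 2# w 1# (λ j → w (prev j))) 1# (T w)
  S-expand w i = begin
    S w i
      ≈⟨ ip-linˡ 1# (lin 2# (e i) 1# (e (prev i))) 1# (λ j → e (prev j) i) w ⟩
    1# * ⟨ lin 2# (e i) 1# (e (prev i)) , w ⟩ + 1# * T w i
      ≈⟨ +-congʳ (*-congˡ (ip-linˡ 2# (e i) 1# (e (prev i)) w)) ⟩
    1# * (2# * ⟨ e i , w ⟩ + 1# * ⟨ e (prev i) , w ⟩) + 1# * T w i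
      ≈⟨ +-congʳ (*-congˡ (+-cong (*-congˡ (trans (ip-comm (e i) w) (ip-e w i))) (*-congˡ (trans (ip-comm (e (prev i)) w) (ip-e w (prev i)))))) ⟩
    1# * (2# * w i + 1# * w (prev i)) + 1# * T w i ∎

  neighbourSum : V N → V N
  neighbourSum w = lin 1# w 1# (λ i → w (prev i))

  -- S is the Gram matrix of the edge–vertex incidence matrix of the rim, hence positive semidefinite.
  S-gram : ∀ w → ⟨ S w , w ⟩ ≈ ⟨ neighbourSum w , neighbourSum w ⟩
  S-gram w = begin
    ⟨ S w , w ⟩
      ≈⟨ ip-congʳ w (S-expand w) ⟩
    ⟨ lin 1# (lin 2# w 1# w′) 1# (T w) , w ⟩
      ≈⟨ trans (ip-linˡ 1# (lin 2# w 1# w′) 1# (T w) w) (+-congʳ (*-congˡ (ip-linˡ 2# w 1# w′ w))) ⟩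
    1# * (2# * ⟨ w , w ⟩ + 1# * ⟨ w′ , w ⟩) + 1# * ⟨ T w , w ⟩
      ≈⟨ +-cong (*-congˡ (+-congˡ (*-congˡ (ip-comm w′ w)))) (*-congˡ T-ip) ⟩
    1# * (2# * ⟨ w , w ⟩ + 1# * ⟨ w , w′ ⟩) + 1# * ⟨ w , w′ ⟩
      ≈⟨ solve 2 (λ a b → :1 :* (:2 :* a :+ :1 :* b) :+ :1 :* b
           := :1 :* (:1 :* a :+ :1 :* b) :+ :1 :* (:1 :* b :+ :1 :* a)) refl ⟨ w , w ⟩ ⟨ w , w′ ⟩ ⟩
    1# * (1# * ⟨ w , w ⟩ + 1# * ⟨ w , w′ ⟩) + 1# * (1# * ⟨ w , w′ ⟩ + 1# * ⟨ w , w ⟩)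
      ≈⟨ +-congˡ (*-congˡ (+-cong (*-congˡ (ip-comm w′ w)) (*-congˡ (sum-prev (λ i → w i * w i))))) ⟨
    1# * (1# * ⟨ w , w ⟩ + 1# * ⟨ w , w′ ⟩) + 1# * (1# * ⟨ w′ , w ⟩ + 1# * ⟨ w′ , w′ ⟩)
      ≈⟨ trans (ip-linˡ 1# w 1# w′ (neighbourSum w)) (+-cong (*-congˡ (ip-linʳ 1# w 1# w′ w)) (*-congˡ (ip-linʳ 1# w 1# w′ w′))) ⟨
    ⟨ neighbourSum w , neighbourSum w ⟩ ∎
    where
    w′ : V N
    w′ i = w (prev i)
    T-ip : ⟨ T w , w ⟩ ≈ ⟨ w , w′ ⟩
    T-ip = begin
      sum (λ i → sum (λ j → e (prev j) i * w j) * w i)      ≈⟨ sum-cong-≋ (λ i → *-distribʳ-sum (w i) (λ j → e (prev j) i * w j)) ⟩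
      sum (λ i → sum (λ j → e (prev j) i * w j * w i))      ≈⟨ ∑-comm (λ i j → e (prev j) i * w j * w i) ⟩
      sum (λ j → sum (λ i → e (prev j) i * w j * w i))      ≈⟨ sum-cong-≋ (λ j → sum-cong-≋ (λ i →
           solve 3 (λ a b c → a :* b :* c := b :* (c :* a)) refl (e (prev j) i) (w j) (w i))) ⟩
      sum (λ j → sum (λ i → w j * (w i * e (prev j) i)))    ≈⟨ sum-cong-≋ (λ j → trans
           (sym (*-distribˡ-sum (w j) (λ i → w i * e (prev j) i))) (*-congˡ {w j} (ip-e w (prev j)))) ⟩
      ⟨ w , w′ ⟩                                            ∎

  Alternating : V N → Set
  Alternating w = ∀ i → w i + w (prev i) ≈ 0#

  negate : ∀ {a b} → a + b ≈ 0# → b ≈ - a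
  negate {a} {b} a+b≈0 = trans (solve 2 (λ a b → b := (a :+ b) :- a) refl a b) (trans (+-congʳ a+b≈0) (+-identityˡ _))

  S-alternating : ∀ {w} → Alternating w → S w ≋ 𝟎
  S-alternating {w} alt i = begin
    S w i                                                   ≈⟨ S-expand w i ⟩
    1# * (2# * w i + 1# * w (prev i)) + 1# * T w i          ≈⟨ +-cong (*-congˡ (+-congˡ (*-congˡ (negate (alt i))))) (*-congˡ Tw≈) ⟩
    1# * (2# * w i + 1# * - w i) + 1# * - w i               ≈⟨ solve 1 (λ w →
         :1 :* (:2 :* w :+ :1 :* :- w) :+ :1 :* :- w := :0) refl (w i) ⟩
    0#                                                      ∎
    where
    Tw≈ : T w i ≈ - w i
    -- Alternation replaces wⱼ by -w at `prev j`; reindexing along `prev` then collapses the sum to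
    -- its term at i.
    Tw≈ = begin
      sum (λ j → e (prev j) i * w j)            ≈⟨ sum-cong-≋ (λ j → *-congˡ {e (prev j) i}
           (negate {w (prev j)} {w j} (trans (+-comm (w (prev j)) (w j)) (alt j)))) ⟩
      sum (λ j → e (prev j) i * - w (prev j))   ≈⟨ sum-prev (λ j → e j i * - w j) ⟩
      sum (λ j → e j i * - w j)                 ≈⟨ sum-cong-≋ (λ j → trans (*-congʳ { - w j} (e-sym j i)) (*-comm (e i j) (- w j))) ⟩
      ⟨ (λ j → - w j) , e i ⟩                   ≈⟨ ip-e (λ j → - w j) i ⟩
      - w i                                     ∎

  -- Summing wᵢ + wᵢ₋₁ around the rim counts every entry twice, whatever the parity of its length.
  total-alternating : ∀ {w} → Alternating w → ⟨ 𝟏 , w ⟩ ≈ 0#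
  total-alternating {w} alt = 2x≈0⇒x≈0 (begin
    ⟨ 𝟏 , w ⟩ + ⟨ 𝟏 , w ⟩                     ≈⟨ +-congˡ (sum-prev (λ i → 1# * w i)) ⟨
    ⟨ 𝟏 , w ⟩ + ⟨ 𝟏 , (λ i → w (prev i)) ⟩    ≈⟨ ∑-distrib-+ (λ i → 1# * w i) (λ i → 1# * w (prev i)) ⟨
    sum (λ i → 1# * w i + 1# * w (prev i))    ≈⟨ sum-cong-≋ (λ i → trans (+-cong (*-identityˡ _) (*-identityˡ _)) (alt i)) ⟩
    sum (λ (_ : Fin N) → 0#)                  ≈⟨ sum-replicate-zero N ⟩
    0#                                        ∎)

  -- The form and the kernel in hub, rim and pendant coordinates.

  module Coordinates (x : V (1 ℕ.+ (N ℕ.+ N))) where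

    a p q : Carrier
    y z w : V N
    a = hubPart x
    y = rimPart x
    z = pendantPart x
    w = lin 1# y 1# z
    p = ⟨ 𝟏 , y ⟩
    q = ⟨ 𝟏 , z ⟩

    -- The parts of the rim and pendant rows of D x that do not depend on i: the contributions of
    -- the hub and of the multiples of J.
    A B : Carrier
    A = a + 2# * p + (2# + 1#) * q
    B = 2# * a + (2# + 1#) * p + (2# + 2#) * q

    S-w : ∀ i → S w i ≈ S y i + S z i
    S-w i = trans (ip-linʳ 1# y 1# z (cyclicRow i)) (+-cong (*-identityˡ _) (*-identityˡ _))

    hub-row : L x (index hub) ≈ p + 2# * q
    hub-row = begin
      L x (index hub)
        ≈⟨ L-row x hub ⟩
      0# * a + (⟨ (λ _ → cast 1) , y ⟩ + ⟨ (λ _ → cast 2) , z ⟩)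
        ≈⟨ +-congˡ (+-cong (const-ip (cast 1) y) (const-ip (cast 2) z)) ⟩
      0# * a + ((1# + 0#) * p + (1# + (1# + 0#)) * q)
        ≈⟨ solve 3 (λ a p q →
             :0 :* a :+ ((:1 :+ :0) :* p :+ (:1 :+ (:1 :+ :0)) :* q) := p :+ :2 :* q) refl a p q ⟩
      p + 2# * q ∎

    rim-row : ∀ i → L x (index (rim i)) ≈ A - S w i
    rim-row i = begin
      L x (index (rim i))
        ≈⟨ L-row x (rim i) ⟩
      (1# + 0#) * a + (⟨ rimRow i , y ⟩ + ⟨ (λ j → cast (suc (rimDistance i j))) , z ⟩)
        ≈⟨ +-congˡ (+-cong (rim-ip i y) (suc-rim-ip i z)) ⟩
      (1# + 0#) * a + ((2# * p - S y i) + (q + (2# * q - S z i)))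
        ≈⟨ solve 5 (λ a p q s t →
             (:1 :+ :0) :* a :+ ((:2 :* p :- s) :+ (q :+ (:2 :* q :- t)))
             := a :+ :2 :* p :+ (:2 :+ :1) :* q :- (s :+ t)) refl a p q (S y i) (S z i) ⟩
      A - (S y i + S z i)
        ≈⟨ +-congˡ (-‿cong (S-w i)) ⟨
      A - S w i ∎

    pendant-row : ∀ i → L x (index (pendant i)) ≈ B - S w i - 2# * z i
    pendant-row i = begin
      L x (index (pendant i))
        ≈⟨ L-row x (pendant i) ⟩
      (1# + (1# + 0#)) * a + (⟨ (λ j → cast (suc (rimDistance i j))) , y ⟩ + ⟨ (λ j → cast (pendantDistance i j)) , z ⟩)
        ≈⟨ +-congˡ (+-cong (suc-rim-ip i y) (pendant-ip i z)) ⟩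
      (1# + (1# + 0#)) * a + ((p + (2# * p - S y i)) + (2# * q + (2# * q - S z i) - 2# * z i))
        ≈⟨ solve 6 (λ a p q s t z →
             (:1 :+ (:1 :+ :0)) :* a :+ ((p :+ (:2 :* p :- s)) :+ (:2 :* q :+ (:2 :* q :- t) :- :2 :* z))
             := :2 :* a :+ (:2 :+ :1) :* p :+ (:2 :+ :2) :* q :- (s :+ t) :- :2 :* z) refl a p q (S y i) (S z i) (z i) ⟩
      B - (S y i + S z i) - 2# * z i
        ≈⟨ +-congʳ (+-congˡ (-‿cong (S-w i))) ⟨
      B - S w i - 2# * z i ∎

    defect : Carrier
    defect = ⟨ neighbourSum w , neighbourSum w ⟩ + 2# * ⟨ z , z ⟩

    form-decomposition : form L x ≈ (p + 2# * q) * (2# * (a + p + q)) - defect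
    form-decomposition = begin
      form L x
        ≈⟨ sum-vertices (λ u → L x u * x u) ⟩
      L x (index hub) * a + (⟨ rimPart (L x) , y ⟩ + ⟨ pendantPart (L x) , z ⟩)
        ≈⟨ +-cong (*-congʳ hub-row) (+-cong rim-part pendant-part) ⟩
      (p + 2# * q) * a + (A * p + - 1# * ⟨ S w , y ⟩ + (1# * (B * q + - 1# * ⟨ S w , z ⟩) + - 2# * ⟨ z , z ⟩))
        -- The terms free of S and z sum to 2a(p + 2q) + 2p² + 6pq + 4q², and the part without a is
        -- 2(p + q)(p + 2q).
        ≈⟨ solve 6 (λ a p q s t n →
             (p :+ :2 :* q) :* a :+ ((a :+ :2 :* p :+ (:2 :+ :1) :* q) :* p :+ :- :1 :* s
               :+ (:1 :* ((:2 :* a :+ (:2 :+ :1) :* p :+ (:2 :+ :2) :* q) :* q :+ :- :1 :* t) :+ :- :2 :* n))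
             := (p :+ :2 :* q) :* (:2 :* (a :+ p :+ q)) :- ((:1 :* s :+ :1 :* t) :+ :2 :* n)) refl a p q ⟨ S w , y ⟩ ⟨ S w , z ⟩ ⟨ z , z ⟩ ⟩
      (p + 2# * q) * (2# * (a + p + q)) - ((1# * ⟨ S w , y ⟩ + 1# * ⟨ S w , z ⟩) + 2# * ⟨ z , z ⟩)
        ≈⟨ +-congˡ (-‿cong (+-congʳ (trans (sym (ip-linʳ 1# y 1# z (S w))) (S-gram w)))) ⟩
      (p + 2# * q) * (2# * (a + p + q)) - defect ∎
      where
      rim-part : ⟨ rimPart (L x) , y ⟩ ≈ A * p + - 1# * ⟨ S w , y ⟩
      rim-part = trans (ip-congʳ y (λ i → trans (rim-row i)
          (solve 2 (λ A s → A :- s := A :* :1 :+ :- :1 :* s) refl A (S w i))))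
        (ip-linˡ A 𝟏 (- 1#) (S w) y)
      pendant-part : ⟨ pendantPart (L x) , z ⟩ ≈ 1# * (B * q + - 1# * ⟨ S w , z ⟩) + - 2# * ⟨ z , z ⟩
      pendant-part = trans (ip-congʳ z (λ i → trans (pendant-row i)
          (solve 3 (λ B s z →
            B :- s :- :2 :* z := :1 :* (B :* :1 :+ :- :1 :* s) :+ :- :2 :* z) refl B (S w i) (z i))))
        (trans (ip-linˡ 1# (lin B 𝟏 (- 1#) (S w)) (- 2#) z z) (+-congʳ (*-congˡ (ip-linˡ B 𝟏 (- 1#) (S w) z))))

    0≤2zz : 0# ≤ 2# * ⟨ z , z ⟩
    0≤2zz = 0≤*0≤ (<⇒≤ 0<2) (0≤norm z)

    0≤defect : 0# ≤ defect
    0≤defect = 0≤+0≤ (0≤norm (neighbourSum w)) 0≤2zz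

    form-on-hyperplane : p + 2# * q ≈ 0# → form L x ≈ - defect
    form-on-hyperplane h≈0 = trans form-decomposition (trans (+-congʳ (trans (*-congʳ h≈0) (zeroˡ _))) (+-identityˡ _))

    hyperplane-nonpositive : L x (index hub) ≈ 0# → form L x ≤ 0#
    hyperplane-nonpositive h≈0 = 0≤-⇒≤ (≤-resp refl
      (trans (sym (-‿involutive defect)) (trans (sym (+-identityˡ _)) (+-congˡ (-‿cong (sym (form-on-hyperplane (trans (sym hub-row) h≈0))))))) 0≤defect)

    -- An exact description of the kernel: necessity bounds its dimension, sufficiency supplies the
    -- kernel vector on a rim of even length.
    record KernelShape : Set where
      field
        a≈0         : a ≈ 0#
        z≋0         : z ≋ 𝟎
        alternating : Alternating y

    -- The hub equation puts x on the hyperplane, where the form is -defect. It also vanishes on the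
    -- kernel, so both nonnegative summands of the defect are zero.
    kernel⇒shape : L x ≋ 𝟎 → KernelShape
    kernel⇒shape Lx≋0 = record { a≈0 = a≈0 ; z≋0 = z≋0 ; alternating = alternating }
      where
      h≈0 : p + 2# * q ≈ 0#
      h≈0 = trans (sym hub-row) (Lx≋0 (index hub))
      defect≈0 : defect ≈ 0#
      defect≈0 = trans (sym (-‿involutive defect)) (trans (-‿cong (trans (sym (form-on-hyperplane h≈0)) (trans (ip-congʳ x Lx≋0) (ip-𝟎ˡ x)))) -0#≈0#)
      z≋0 : z ≋ 𝟎
      z≋0 = norm≈0⇒≋𝟎 z (no-zero-divisors (0≤+0≤≈0ʳ (0≤norm (neighbourSum w)) 0≤2zz defect≈0) (positive⇒nonzero 0<2))
      neighbours≈0 : neighbourSum w ≋ 𝟎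
      neighbours≈0 = norm≈0⇒≋𝟎 (neighbourSum w) (0≤+0≤≈0ˡ (0≤norm (neighbourSum w)) 0≤2zz defect≈0)
      w≋y : w ≋ y
      w≋y i = trans (+-cong (*-identityˡ _) (trans (*-identityˡ _) (z≋0 i))) (+-identityʳ _)
      w-alternating : Alternating w
      w-alternating i = trans (sym (+-cong (*-identityˡ _) (*-identityˡ _))) (neighbours≈0 i)
      alternating : Alternating y
      alternating i = trans (sym (+-cong (w≋y i) (w≋y (prev i)))) (w-alternating i)
      a≈0 : a ≈ 0#
      -- Any single rim equation gives a, since p, q and S w are already zero.
      a≈0 = begin
        a
          ≈⟨ solve 4 (λ a p q s →
               a := a :+ :2 :* p :+ (:2 :+ :1) :* q :- s :- (:2 :* p :+ (:2 :+ :1) :* q) :+ s) refl a p q (S w zero) ⟩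
        A - S w zero - (2# * p + (2# + 1#) * q) + S w zero
          ≈⟨ +-cong (+-cong (trans (sym (rim-row zero)) (Lx≋0 (index (rim zero))))
               (-‿cong (+-cong (*-congˡ (total-alternating alternating)) (*-congˡ (trans (ip-congˡ 𝟏 z≋0) (ip-𝟎ʳ {N} 𝟏))))))
               (S-alternating w-alternating zero) ⟩
        0# - (2# * 0# + (2# + 1#) * 0#) + 0#
          ≈⟨ solve 0 (:0 :- (:2 :* :0 :+ (:2 :+ :1) :* :0) :+ :0 := :0) refl ⟩
        0# ∎

    shape⇒kernel : KernelShape → L x ≋ 𝟎
    shape⇒kernel shape = vertex-cases {λ u → L x u ≈ 0#}
      (trans hub-row (trans (+-cong p≈0 (*-congˡ q≈0)) (solve 0 (:0 :+ :2 :* :0 := :0) refl)))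
      (λ i → trans (rim-row i) (trans (+-cong A≈0 (-‿cong (Sw≈0 i))) (-‿inverseʳ 0#)))
      (λ i → trans (pendant-row i) (trans (+-cong (+-cong B≈0 (-‿cong (Sw≈0 i))) (-‿cong (*-congˡ (z≋0 i))))
        (solve 0 (:0 :- :0 :- :2 :* :0 := :0) refl)))
      where
      open KernelShape shape
      p≈0 : p ≈ 0#
      p≈0 = total-alternating alternating
      q≈0 : q ≈ 0#
      q≈0 = trans (ip-congˡ 𝟏 z≋0) (ip-𝟎ʳ {N} 𝟏)
      w≋y : w ≋ y
      w≋y i = trans (+-cong (*-identityˡ _) (trans (*-identityˡ _) (z≋0 i))) (+-identityʳ _)
      Sw≈0 : S w ≋ 𝟎
      Sw≈0 = S-alternating (λ i → trans (+-cong (w≋y i) (w≋y (prev i))) (alternating i))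
      A≈0 : A ≈ 0#
      A≈0 = trans (+-cong (+-cong a≈0 (*-congˡ p≈0)) (*-congˡ q≈0))
        (solve 0 (:0 :+ :2 :* :0 :+ (:2 :+ :1) :* :0 := :0) refl)
      B≈0 : B ≈ 0#
      B≈0 = trans (+-cong (+-cong (*-congˡ a≈0) (*-congˡ p≈0)) (*-congˡ q≈0))
        (solve 0 (:2 :* :0 :+ (:2 :+ :1) :* :0 :+ (:2 :+ :2) :* :0 := :0) refl)

  L-entry : ∀ u v → ⟨ L (e u) , e v ⟩ ≈ D v u
  L-entry u v = trans (ip-e (L (e u)) v) (ip-e (D v) u)

  -- The diagonal of D is zero, so the sum of two basis vectors has form twice the distance of their
  -- vertices, here the hub and a rim vertex.
  form-positive : ∃[ x ] 0# < form L x
  form-positive = x , <-respʳ-≈ (sym formx) 0<2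
    where
    u v : Fin (1 ℕ.+ (N ℕ.+ N))
    u = index hub
    v = index (rim zero)
    x = lin 1# (e u) 1# (e v)
    formx : form L x ≈ 2#
    formx = begin
      form L x
        ≈⟨ form-lin L-selfAdjoint 1# (e u) 1# (e v) ⟩
      1# * 1# * form L (e u) + 2# * (1# * 1# * ⟨ L (e u) , e v ⟩) + 1# * 1# * form L (e v)
        ≈⟨ +-cong (+-cong (*-congˡ (L-entry u u)) (*-congˡ (*-congˡ (L-entry u v)))) (*-congˡ (L-entry v v)) ⟩
      1# * 1# * cast 0 + 2# * (1# * 1# * cast 1) + 1# * 1# * cast 0
        ≈⟨ solve 0 (:1 :* :1 :* :0 :+ :2 :* (:1 :* :1 :* (:1 :+ :0)) :+ :1 :* :1 :* :0 := :2) refl ⟩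
      2# ∎

  -- Taking the hub row of D as the normal vector makes the hypothesis definitionally the hub
  -- equation of D x = 0.
  hyperplane : ∀ x → ⟨ D (index hub) , x ⟩ ≈ 0# → form L x ≤ 0#
  hyperplane x = Coordinates.hyperplane-nonpositive x

  -- Parity of the rim.

  sign : ℕ → Carrier
  sign zero    = 1#
  sign (suc n) = - sign n

  Alternating⇒sign : ∀ {w} → Alternating w → ∀ i → w i ≈ sign (toℕ i) * w zero
  Alternating⇒sign {w} alt = <-weakInduction (λ i → w i ≈ sign (toℕ i) * w zero) (sym (*-identityˡ _)) step
    where
    step : ∀ i → w (inject₁ i) ≈ sign (toℕ (inject₁ i)) * w zero → w (suc i) ≈ - sign (toℕ i) * w zero
    step i ih = begin
      w (suc i)                                    ≈⟨ negate (trans (+-comm (w (inject₁ i)) (w (suc i))) (alt (suc i))) ⟩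
      - w (inject₁ i)                              ≈⟨ -‿cong ih ⟩
      - (sign (toℕ (inject₁ i)) * w zero)          ≡⟨ ≡.cong (λ n → - (sign n * w zero)) (Fin.toℕ-inject₁ i) ⟩
      - (sign (toℕ i) * w zero)                    ≈⟨ -‿distribˡ-* _ _ ⟩
      - sign (toℕ i) * w zero                      ∎

  -- The last rim index is 2 + k = N - 1. With sign 1 there, the first and last entries agree, while
  -- the edge closing the cycle makes them opposite.
  Alternating-even⇒0 : ∀ {w} → sign (2 ℕ.+ k) ≈ 1# → Alternating w → w ≋ 𝟎
  Alternating-even⇒0 {w} even alt i = trans (Alternating⇒sign alt i) (trans (*-congˡ w₀≈0) (zeroʳ _))
    where
    last≈ : w (fromℕ (2 ℕ.+ k)) ≈ w zero
    last≈ = begin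
      w (fromℕ (2 ℕ.+ k))                              ≈⟨ Alternating⇒sign {w} alt (fromℕ (2 ℕ.+ k)) ⟩
      sign (toℕ (fromℕ (2 ℕ.+ k))) * w zero            ≡⟨ ≡.cong (λ n → sign n * w zero) (Fin.toℕ-fromℕ (2 ℕ.+ k)) ⟩
      sign (2 ℕ.+ k) * w zero                          ≈⟨ trans (*-congʳ even) (*-identityˡ _) ⟩
      w zero                                           ∎
    w₀≈0 : w zero ≈ 0#
    w₀≈0 = 2x≈0⇒x≈0 (trans (+-congˡ (sym last≈)) (alt zero))

  injective : sign (2 ℕ.+ k) ≈ 1# → ∀ x → L x ≋ 𝟎 → x ≋ 𝟎
  injective even x Lx≋0 = vertex-cases {λ u → x u ≈ 0#} a≈0 (Alternating-even⇒0 {Coordinates.y x} even alternating) z≋0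
    where open Coordinates.KernelShape (Coordinates.kernel⇒shape x Lx≋0)

  alternatingAt : Vertex → Carrier
  alternatingAt hub         = 0#
  alternatingAt (rim i)     = sign (toℕ i)
  alternatingAt (pendant i) = 0#

  kernelVector : V (1 ℕ.+ (N ℕ.+ N))
  kernelVector u = alternatingAt (helmVertex N u)

  kernelVector-index : ∀ U → kernelVector (index U) ≈ alternatingAt U
  kernelVector-index U = reflexive (≡.cong alternatingAt (helmVertex-index U))

  kernelVector-kernel : sign (2 ℕ.+ k) ≈ - 1# → L kernelVector ≋ 𝟎
  kernelVector-kernel odd = Coordinates.shape⇒kernel kernelVector (record
    { a≈0         = kernelVector-index hub
    ; z≋0         = λ i → kernelVector-index (pendant i)
    ; alternating = λ i → trans (+-cong (kernelVector-index (rim i)) (kernelVector-index (rim (prev i)))) (alternating i)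
    })
    where
    alternating : Alternating (λ i → sign (toℕ i))
    -- Only the edge closing the cycle depends on parity; along the others the signs alternate by
    -- definition.
    alternating zero = trans (+-congˡ (trans (reflexive (≡.cong sign (Fin.toℕ-fromℕ (2 ℕ.+ k)))) odd)) (-‿inverseʳ 1#)
    alternating (suc i) = trans (+-congˡ (reflexive (≡.cong sign (Fin.toℕ-inject₁ i)))) (-‿inverseˡ _)

  kernelVector≉0 : ¬ (kernelVector ≋ 𝟎)
  kernelVector≉0 zeros = positive⇒nonzero 0<1 (trans (sym (kernelVector-index (rim zero))) (zeros (index (rim zero))))

  kernel-spanned : ∀ x → L x ≋ 𝟎 → ∃[ c ] x ≋ c • kernelVector
  kernel-spanned x Lx≋0 = c , vertex-cases {λ u → x u ≈ c * kernelVector u}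
    (trans a≈0 (sym (trans (*-congˡ (kernelVector-index hub)) (zeroʳ c))))
    (λ i → trans (Alternating⇒sign {Coordinates.y x} alternating i) (trans (*-comm _ _) (*-congˡ (sym (kernelVector-index (rim i))))))
    (λ i → trans (z≋0 i) (sym (trans (*-congˡ (kernelVector-index (pendant i))) (zeroʳ c))))
    where
    open Coordinates.KernelShape (Coordinates.kernel⇒shape x Lx≋0)
    c : Carrier
    c = Coordinates.y x zero

  -- Divisibility and sign are carried together in steps of two, so either determines the other. It
  -- is applied to 2 + k, which has the parity of n = 4 + k.
  sign-parity : ∀ n → (2 ∣ n × sign n ≈ 1#) ⊎ (¬ (2 ∣ n) × sign n ≈ - 1#)
  sign-parity zero          = inj₁ (2 ∣0 , refl)
  sign-parity (suc zero)    = inj₂ ((λ 2∣1 → ℕ.<-irrefl ≡.refl (∣⇒≤ 2∣1)) , refl)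
  sign-parity (suc (suc n)) with sign-parity n
  ... | inj₁ (2∣n , eq) = inj₁ (∣m∣n⇒∣m+n ∣-refl 2∣n , trans (-‿involutive _) eq)
  ... | inj₂ (2∤n , eq) = inj₂ ((λ 2∣2+n → 2∤n (∣m+n∣m⇒∣n 2∣2+n ∣-refl)) , trans (-‿involutive _) eq)

  even⇒sign : 2 ∣ 2 ℕ.+ k → sign (2 ℕ.+ k) ≈ 1#
  even⇒sign 2∣ with sign-parity (2 ℕ.+ k)
  ... | inj₁ (_ , eq) = eq
  ... | inj₂ (2∤ , _) = ⊥-elim (2∤ 2∣)

  odd⇒sign : ¬ (2 ∣ 2 ℕ.+ k) → sign (2 ℕ.+ k) ≈ - 1#
  odd⇒sign 2∤ with sign-parity (2 ℕ.+ k)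
  ... | inj₁ (2∣ , _) = ⊥-elim (2∤ 2∣)
  ... | inj₂ (_ , eq) = eq

  inertia-even : 2 ∣ 4 ℕ.+ k → HasInertia D (1 , 2 ℕ.* (4 ℕ.+ k) ℕ.∸ 2 , 0)
  inertia-even 2∣n = inertia D-symmetric
    (λ sa B → EigenvalueCount.one-positive sa B (D (index hub)) form-positive hyperplane ,
              EigenvalueCount.no-zero sa B (injective (even⇒sign (∣m+n∣m⇒∣n 2∣n ∣-refl))))
    (even-total k)

  inertia-odd : ¬ (2 ∣ 4 ℕ.+ k) → HasInertia D (1 , 2 ℕ.* (4 ℕ.+ k) ℕ.∸ 3 , 1)
  inertia-odd 2∤n = inertia D-symmetric
    (λ sa B → EigenvalueCount.one-positive sa B (D (index hub)) form-positive hyperplane ,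
              EigenvalueCount.one-zero sa B kernelVector≉0
                (kernelVector-kernel (odd⇒sign (λ 2∣ → 2∤n (∣m∣n⇒∣m+n ∣-refl 2∣)))) kernel-spanned)
    (odd-total k)

open import Data.Nat using (ℕ; _≤_; _*_; _∸_)

theorem3p3 : (ℝ : Reals) (n : ℕ) (4≤n : 4 ≤ n) →
    let open Inertia ℝ in
    Σ[ D ∈ DistanceMatrix (helm n 4≤n) ]
    ((2 ∣ n → HasInertia (fromNatMatrix (DistanceMatrix.dist D)) (1 , 2 * n ∸ 2 , 0)) ×
    (¬ (2 ∣ n) → HasInertia (fromNatMatrix (DistanceMatrix.dist D)) (1 , 2 * n ∸ 3 , 1)))
theorem3p3 ℝ n 4≤n@(s≤s (s≤s (s≤s (s≤s {n = k} _)))) =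
  HelmDistance.distanceMatrix (2 ℕ.+ k) (helm n 4≤n) ≡.refl , HelmMatrix.inertia-even ℝ k , HelmMatrix.inertia-odd ℝ k
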